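{- Let $\psi(t)=\sum_{p\ge 0} w_p t^p$ be the formal power series in which $w_p$ is the number of Wicketed Ferrers diagrams of half-perimeter $p$ (as defined in the context). Then $\psi$ satisfies the quadratic equation $$(2 t-1)^8 \psi^2 -t^6 (2 t-1)^4 \psi + t^{14} = 0.$$
   Context: A Ferrers diagram (in this convention) is a finite collection of rows of unit square cells stacked vertically, numbered from bottom to top, all rows left-aligned (row $i$ occupies columns $1,\dots,m_i$), with row lengths $1\le m_1\le m_2\le\cdots$ nondecreasing upward. Its half-perimeter is (top width) + (number of rows). A Wicketed Ferrers diagram is a Ferrers diagram from which another Ferrers diagram (same conventions) is removed from the interior, forming a hole (the wicket). Precisely, it is given by integers $1\le j<n<N$, an integer $\ell\ge1$, integers $m_1,\dots,m_N$ and $g_{j+1},\dots,g_n$ such that: for $i\le j$ and for $n<i\le N$, row $i$ is a full row occupying columns $1,\dots,m_i$; for $j<i\le n$, row $i$ occupies columns $1,\dots,\ell$ and columns $g_i+1,\dots,m_i$, the columns $\ell+1,\dots,g_i$ being empty, where $\ell<g_i<m_i$; moreover $g_{j+1}<m_j$, and for $j<i<n$: $g_i\le g_{i+1}<m_i$; and $m_1\le m_2\le\dots\le m_N$. (Thus the removed cells form a left-aligned Ferrers shape lying strictly inside the diagram, covered below by row $j$ and above by the full row $n+1$.) Its half-perimeter is half the total boundary length of the union of its cells, counting both the outer boundary and the boundary of the hole; this equals $m_N+N+(n-j)+(g_n-\ell)$. -}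

module Defs where

open import Data.Nat using (ℕ; zero; suc; _+_; _∸_; _≤_; _<_; _≟_)
open import Relation.Nullary using (yes; no)
open import Data.Integer as ℤ using (ℤ; +_; -[1+_])
open import Data.List using (List; applyUpTo; upTo; map; foldr)
open import Data.List.Relation.Unary.All using (All)
open import Data.Vec using (Vec; []; _∷_)
open import Data.Product using (_×_)
open import Relation.Binary.PropositionalEquality using (_≡_)

-- 1-based access to a vector of naturals (value 0 outside 1..k; only
-- ever used at in-range indices below).

at : ∀ {k} → Vec ℕ k → ℕ → ℕ
at []      _             = 0
at (x ∷ v) zero          = 0
at (x ∷ v) (suc zero)    = x
at (x ∷ v) (suc (suc i)) = at v (suc i)

range : ℕ → ℕ → List ℕ
range a b = applyUpTo (λ i → a + i) (suc b ∸ a)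

-- Wicketed Ferrers diagrams of half-perimeter p.
-- Rows are numbered 1..N; m i = length of row i (vector m, 1-based);
-- for j < i ≤ n, g_i is stored as  at g (i ∸ j)  (vector g of length n ∸ j).

record WFD (p : ℕ) : Set where
  field
    j n N ℓ : ℕ
    m : Vec ℕ N
    g : Vec ℕ (n ∸ j)
    1≤j : 1 ≤ j
    j<n : j < n
    n<N : n < N
    1≤ℓ : 1 ≤ ℓ
    1≤m₁ : 1 ≤ at m 1
    m-mono : All (λ i → at m i ≤ at m (suc i)) (range 1 (N ∸ 1))
    hole : All (λ i → ℓ < at g (i ∸ j) × at g (i ∸ j) < at m i) (range (suc j) n)
    bottom : at g 1 < at m j
    hole-mono : All (λ i → at g (i ∸ j) ≤ at g (suc i ∸ j) × at g (suc i ∸ j) < at m i)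
                    (range (suc j) (n ∸ 1))
    perim : at m N + N + (n ∸ j) + (at g (n ∸ j) ∸ ℓ) ≡ p

Series : Set
Series = ℕ → ℤ

_⊕_ : Series → Series → Series
(f ⊕ g) k = f k ℤ.+ g k

_⊖_ : Series → Series → Series
(f ⊖ g) k = f k ℤ.- g k

_⊛_ : Series → Series → Series
(f ⊛ g) k = foldr ℤ._+_ (+ 0) (map (λ i → f i ℤ.* g (k ∸ i)) (upTo (suc k)))

infixl 6 _⊕_ _⊖_
infixl 7 _⊛_

tpow : ℕ → Series
tpow d k with d ≟ k
... | yes _ = + 1
... | no _  = + 0

one : Series
one = tpow 0

_^^_ : Series → ℕ → Series
s ^^ zero  = one
s ^^ suc e = s ⊛ (s ^^ e)

2t-1 : Series
2t-1 zero          = -[1+ 0 ]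
2t-1 (suc zero)    = + 2
2t-1 (suc (suc _)) = + 0

series : (ℕ → ℕ) → Series
series w k = + w k

{-# OPTIONS --safe #-}
-- Read from the bottom up, a diagram is a word of unit steps that widen or
-- complete the current row or move the end of the hole. Until the hole closes
-- only the distance between the end of the hole and the end of the row
-- constrains the next step, so the generating functions satisfy a linear
-- system indexed by that distance. Each equation is guarded by a factor t,
-- hence the solution is unique, and the kernel method provides it in closed
-- form in terms of the series z = t + t z². It yields ψ = t⁷ z / (1 - 2t)⁴,
-- and the quadratic equation for ψ is that of z.
module Submission where

open import Defs
open import Data.Nat as ℕ using (ℕ; zero; suc)
open import Data.Fin as Fin using (Fin)
open import Data.Integer as ℤ using (ℤ; +_; -[1+_])
open import Function.Bundles using (_↔_; mk↔ₛ′)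
open import Relation.Binary.PropositionalEquality as ≡ using (_≡_; refl; cong; cong₂)
import Data.Nat.Properties as ℕ
import Data.Integer.Properties as ℤ
open import Data.Maybe using (Maybe; just; nothing)
open import Data.Unit using (⊤; tt)
open import Level as Level using (0ℓ; _⊔_)
open import Relation.Nullary using (yes; no; contradiction)
open import Algebra.Bundles using (CommutativeRing; RawRing)
open import Algebra.Solver.Ring.AlmostCommutativeRing
  using (AlmostCommutativeRing; fromCommutativeRing; _-Raw-AlmostCommutative⟶_)
import Algebra.Solver.Ring
import Algebra.Properties.Group as GroupProperties
import Algebra.Properties.CommutativeSemigroup as CommutativeSemigroupProperties

-- Solving the linear system

-- A trial solution x^e of the homogeneous equations for `Q` and `P` requires (x - t)(1 - t x) = t²
-- x, which simplifies to x = t + t x². Its root z is a power series; the other root 1/z is not. The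
-- source `T` = t/(1 - 2t) contributes the constant solution t³/(1 - 2t)² of `Q`, and the boundary
-- equation for `Q 0`, which amounts to `Q` being zero at distance -1, fixes the multiple of z^(e+1)
-- subtracted from it.
--
-- Nothing is ever divided. The closed forms are multiplied out by powers of u = 1 - 2t, and the
-- resulting errors are shown to solve the homogeneous guarded system, so they are zero. The powers
-- of z are represented by a sequence `Z` with a linear recurrence, which makes the checks of the
-- closed forms linear in `Z`; a genuine square of z enters only in the final quadratic.
--
-- On the combinatorial side, the inequalities of a diagram are indexed by row numbers while a path
-- is inductive. Both are compared with the row-by-row predicate `Rows`, and the half-perimeter is
-- recovered from an additive invariant of paths.

ℤ-rawRing : RawRing _ _
ℤ-rawRing = CommutativeRing.rawRing ℤ.+-*-commutativeRing

module Elimination {c ℓ} (R : CommutativeRing c ℓ)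
  (φ : ℤ-rawRing -Raw-AlmostCommutative⟶ fromCommutativeRing R) where

  open CommutativeRing R hiding (refl)
  open CommutativeRing R using () renaming (refl to ≈-refl)
  open GroupProperties +-group using (x∙y⁻¹≈ε⇒x≈y)
  open _-Raw-AlmostCommutative⟶_ φ using (⟦_⟧)

  private
    coeff≟ : ∀ x y → Maybe (⟦ x ⟧ ≈ ⟦ y ⟧)
    coeff≟ x y with x ℤ.≟ y
    ... | yes refl = just ≈-refl
    ... | no _     = nothing

  open Algebra.Solver.Ring ℤ-rawRing (fromCommutativeRing R) φ coeff≟
    using (Polynomial; solve; con; _:+_; _:*_; _:-_; _:=_)

  residual : ∀ {a b} → a ≈ b → a + - b ≈ 0#
  residual {a} {b} p = trans (+-cong p ≈-refl) (-‿inverseʳ b)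

  -- With residuals of hypotheses for r, an equation that holds modulo the
  -- hypotheses becomes a polynomial identity with explicit cofactors c.
  dropMultiple : ∀ {r c x y} → r ≈ 0# → x ≈ y + c * r → x ≈ y
  dropMultiple {r} {c} {x} {y} r≈0 p = trans p
    (trans (+-cong ≈-refl (trans (*-cong {c} ≈-refl r≈0) (zeroʳ c))) (+-identityʳ y))

  -- The solver evaluates its literal 1 to ⟦ + 1 ⟧, which is only ≈ to 1#.
  1′ : Carrier
  1′ = ⟦ + 1 ⟧

  1ₚ : ∀ {n} → Polynomial n
  1ₚ = con (+ 1)

  module _ (t : Carrier) where

    u : Carrier
    u = 1′ - (t + t)

    -- Distances from the closed forms, found by the kernel method:
    --   u² Q e = t³ (1 - z^(e+1)),  u² P e = t³ (1 - t - t z^(e+2)),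
    --   u³ F f = t⁴ (1 - t - t z^(f+2) + t z^(f+3)),  u³ E = t⁴ z.
    errLeft errRight errFree : Carrier → Carrier → Carrier
    errLeft  q z = u * (u * q) - t * (t * (t * (1′ - z)))
    errRight p z = u * (u * p) - t * (t * (t * ((1′ - t) - t * z)))
    errFree  e z = u * (u * (u * e)) - t * (t * (t * (t * z)))

    errBase : Carrier → Carrier → Carrier → Carrier
    errBase f z z′ = u * (u * (u * f)) - t * (t * (t * (t * ((1′ - t) - t * z + t * z′))))

  module _ {n : ℕ} (t : Polynomial n) where

    uₚ : Polynomial n
    uₚ = 1ₚ :- (t :+ t)

    errLeftₚ errRightₚ errFreeₚ : Polynomial n → Polynomial n → Polynomial n
    errLeftₚ  q z = uₚ :* (uₚ :* q) :- t :* (t :* (t :* (1ₚ :- z)))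
    errRightₚ p z = uₚ :* (uₚ :* p) :- t :* (t :* (t :* ((1ₚ :- t) :- t :* z)))
    errFreeₚ  e z = uₚ :* (uₚ :* (uₚ :* e)) :- t :* (t :* (t :* (t :* z)))

    errBaseₚ : Polynomial n → Polynomial n → Polynomial n → Polynomial n
    errBaseₚ f z z′ = uₚ :* (uₚ :* (uₚ :* f)) :- t :* (t :* (t :* (t :* ((1ₚ :- t) :- t :* z :+ t :* z′))))

  product-zero : ∀ z {z₀} → z₀ ≈ 1′ → z * z₀ - z ≈ 0#
  product-zero z {z₀} p = trans (dropMultiple (residual p)
    (solve 2 (λ z z₀ → z :* z₀ :- z := z :* (1ₚ :- 1ₚ) :+ z :* (z₀ :- 1ₚ)) ≈-refl z z₀))
    (trans (*-cong {z} ≈-refl (-‿inverseʳ 1′)) (zeroʳ z))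

  product-suc : ∀ t z {z₀ z₁ z₂ z₃} → z₁ ≈ t * z₀ + t * z₂ → z₂ ≈ t * z₁ + t * z₃ →
    z * z₁ - z₂ ≈ t * (z * z₀ - z₁) + t * (z * z₂ - z₃)
  product-suc t z {z₀} {z₁} {z₂} {z₃} p q = dropMultiple (residual q) (dropMultiple (residual p)
    (solve 6 (λ t z a b c d → z :* b :- c :=
        t :* (z :* a :- b) :+ t :* (z :* c :- d)
        :+ con -[1+ 0 ] :* (c :- (t :* b :+ t :* d))
        :+ z :* (b :- (t :* a :+ t :* c)))
      ≈-refl t z z₀ z₁ z₂ z₃))

  -- The boundary condition fits the closed forms because 1 - z = 1 - t - t z² is the equation of z
  -- itself.
  errLeft-zero : ∀ t {q p z₁ z₂} → q ≈ p → z₁ ≈ t + t * z₂ →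
    errLeft t q z₁ ≈ errRight t p z₂
  errLeft-zero t {q} {p} {z₁} {z₂} q≈p z₁≈ = dropMultiple (residual z₁≈) (dropMultiple (residual q≈p)
    (solve 5 (λ t q p z₁ z₂ → errLeftₚ t q z₁ :=
        errRightₚ t p z₂
        :+ t :* (t :* t) :* (z₁ :- (t :+ t :* z₂))
        :+ uₚ t :* uₚ t :* (q :- p))
      ≈-refl t q p z₁ z₂))

  errLeft-suc : ∀ t {q q′ p z₁ z₂ z₃} → q ≈ t * q′ + p → z₂ ≈ t * z₁ + t * z₃ →
    errLeft t q z₂ ≈ t * errLeft t q′ z₁ + errRight t p z₃
  errLeft-suc t {q} {q′} {p} {z₁} {z₂} {z₃} q≈ z₂≈ = dropMultiple (residual z₂≈) (dropMultiple (residual q≈)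
    (solve 7 (λ t q q′ p z₁ z₂ z₃ → errLeftₚ t q z₂ :=
        t :* errLeftₚ t q′ z₁ :+ errRightₚ t p z₃
        :+ t :* (t :* t) :* (z₂ :- (t :* z₁ :+ t :* z₃))
        :+ uₚ t :* uₚ t :* (q :- (t :* q′ :+ p)))
      ≈-refl t q q′ p z₁ z₂ z₃))

  -- The source `T` disappears here: u T = t turns u² t² T into u t³, which matches the constant
  -- terms since (1 - t) - t (1 - t) - t² = u.
  errRight-step : ∀ t {T m q p p′ z₁ z₂ z₃} →
    T ≈ t + (t * T + t * T) → m ≈ T + q → p ≈ t * p′ + t * (t * m) →
    z₂ ≈ t * z₁ + t * z₃ →
    errRight t p z₂ ≈ t * errRight t p′ z₃ + t * (t * errLeft t q z₁)
  errRight-step t {T} {m} {q} {p} {p′} {z₁} {z₂} {z₃} T≈ m≈ p≈ z₂≈ =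
    dropMultiple (residual z₂≈) (dropMultiple (residual T≈) (dropMultiple (residual m≈) (dropMultiple (residual p≈)
    (solve 9 (λ t T m q p p′ z₁ z₂ z₃ → errRightₚ t p z₂ :=
        t :* errRightₚ t p′ z₃ :+ t :* (t :* errLeftₚ t q z₁)
        :+ t :* t :* (t :* t) :* (z₂ :- (t :* z₁ :+ t :* z₃))
        :+ uₚ t :* (t :* t) :* (T :- (t :+ (t :* T :+ t :* T)))
        :+ uₚ t :* uₚ t :* (t :* t) :* (m :- (T :+ q))
        :+ uₚ t :* uₚ t :* (p :- (t :* p′ :+ t :* (t :* m))))
      ≈-refl t T m q p p′ z₁ z₂ z₃))))

  errBase-step : ∀ t {f f′ p z₂ z₃ z₄} →
    f ≈ t * f + (t * f′ + t * p) → errRight t p z₂ ≈ 0# → z₃ ≈ t * z₂ + t * z₄ →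
    errBase t f z₂ z₃ ≈ t * errBase t f z₂ z₃ + t * errBase t f′ z₃ z₄
  errBase-step t {f} {f′} {p} {z₂} {z₃} {z₄} f≈ p≈ z₃≈ =
    dropMultiple (residual z₃≈) (dropMultiple p≈ (dropMultiple (residual f≈)
    (solve 7 (λ t f f′ p z₂ z₃ z₄ → errBaseₚ t f z₂ z₃ :=
        t :* errBaseₚ t f z₂ z₃ :+ t :* errBaseₚ t f′ z₃ z₄
        :+ con -[1+ 0 ] :* (t :* t :* (t :* (t :* t))) :* (z₃ :- (t :* z₂ :+ t :* z₄))
        :+ uₚ t :* t :* errRightₚ t p z₂
        :+ uₚ t :* (uₚ t :* uₚ t) :* (f :- (t :* f :+ (t :* f′ :+ t :* p))))
      ≈-refl t f f′ p z₂ z₃ z₄)))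

  -- By t z² = z - t, the closed form of `F 0` satisfies t (1 - t - t z² + t z³) = (1 - t - t²) z.
  -- The factor 1 - t - t² is that of the equation for `E`, so it cancels and leaves no trace in ψ.
  errFree-step : ∀ t {e f z₁ z₂ z₃} →
    e ≈ t * e + (t * (t * e) + t * f) → errBase t f z₂ z₃ ≈ 0# →
    z₁ ≈ t + t * z₂ → z₂ ≈ t * z₁ + t * z₃ →
    errFree t e z₁ ≈ t * errFree t e z₁ + t * (t * errFree t e z₁)
  errFree-step t {e} {f} {z₁} {z₂} {z₃} e≈ f≈ z₁≈ z₂≈ =
    dropMultiple (residual z₁≈) (dropMultiple (residual z₂≈) (dropMultiple f≈ (dropMultiple (residual e≈)
    (solve 6 (λ t e f z₁ z₂ z₃ → errFreeₚ t e z₁ :=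
        t :* errFreeₚ t e z₁ :+ t :* (t :* errFreeₚ t e z₁)
        :+ con -[1+ 0 ] :* (t :* t :* (t :* t)) :* (1ₚ :- t) :* (z₁ :- (t :+ t :* z₂))
        :+ con -[1+ 0 ] :* (t :* t :* (t :* (t :* t))) :* (z₂ :- (t :* z₁ :+ t :* z₃))
        :+ t :* errBaseₚ t f z₂ z₃
        :+ uₚ t :* (uₚ t :* uₚ t) :* (e :- (t :* e :+ (t :* (t :* e) :+ t :* f))))
      ≈-refl t e f z₁ z₂ z₃))))

  pow : Carrier → ℕ → Carrier
  pow x zero    = 1#
  pow x (suc k) = x * pow x k

  powers : ∀ t (x : ℕ → Carrier) → x 0 ≈ 1# → (∀ d → x (suc d) ≈ t * x d) →
    ∀ d → x d ≈ pow t d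
  powers t x x₀ xₛ zero    = x₀
  powers t x x₀ xₛ (suc d) = trans (xₛ d) (*-cong ≈-refl (powers t x x₀ xₛ d))

  -- Since s = -u, even powers of s are powers of u, and v w = t⁷ z for v = u⁴. Substituting t⁷ z
  -- for v w in the quadratic leaves t¹³ (t z² - z + t), which is zero.
  root⇒quadratic : ∀ t s {w l e z₁ z₂ a b} →
    s ≈ t + t - 1′ → 1# ≈ 1′ →
    w ≈ t * l → l ≈ (t * l + t * l) + t * (t * e) → errFree t e z₁ ≈ 0# →
    z₁ ≈ t + t * z₂ → z₁ * z₁ ≈ z₂ →
    a ≈ pow t 6 → b ≈ pow t 14 →
    pow s 8 * w * w - a * pow s 4 * w + b ≈ 0#
  root⇒quadratic t s {w} {l} {e} {z₁} {z₂} {a} {b} s≈ 1≈ w≈ l≈ e≈ z₁≈ z₂≈ a≈ b≈ = trans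
    (+-cong (+-cong (*-cong (*-cong s⁸≈ ≈-refl) ≈-refl) (-‿cong (*-cong (*-cong a≈t⁶ s⁴≈) ≈-refl))) b≈t¹⁴)
    (trans (dropMultiple (residual z₁≈) (dropMultiple (residual z₂≈) (dropMultiple root
      (solve 5 (λ t v w z₁ z₂ →
          v :* v :* w :* w :- t⁶ₚ t :* v :* w :+ t² t :* t⁶ₚ t :* t⁶ₚ t
          -- `t :- t` plays zero: a literal 0 would evaluate to the image of the integer 0, which is
          -- only ≈ to `0#`. The last cofactor is the quotient on replacing v w by t⁷ z.
          := (t :- t) :+ con -[1+ 0 ] :* (t :* t⁶ₚ t :* t⁶ₚ t) :* (z₁ :- (t :+ t :* z₂))
          :+ t² t :* t⁶ₚ t :* t⁶ₚ t :* (z₁ :* z₁ :- z₂)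
          :+ (v :* w :+ t :* t⁶ₚ t :* z₁ :- t⁶ₚ t) :* (v :* w :- t :* t⁶ₚ t :* z₁))
        ≈-refl t v w z₁ z₂))))
      (-‿inverseʳ t))
    where
    -- `pow` ends in `1#`, which is no solver literal; it becomes the variable `o`, and `o :- 1ₚ` is
    -- removed as a residual.
    powₚ : ∀ {n} → Polynomial n → ℕ → Polynomial n → Polynomial n
    powₚ x zero    o = o
    powₚ x (suc k) o = x :* powₚ x k o
    t² t⁶ₚ : ∀ {n} → Polynomial n → Polynomial n
    t² t = t :* t
    t⁶ₚ t = t² t :* (t² t :* t² t)
    t⁶ v : Carrier
    t⁶ = t * t * (t * t * (t * t))
    v = u t * u t * (u t * u t)
    s⁴≈ : pow s 4 ≈ v
    s⁴≈ = dropMultiple (residual s≈) (dropMultiple (residual 1≈)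
      (solve 3 (λ t s o →
          powₚ s 4 o :=
          uₚ t :* uₚ t :* (uₚ t :* uₚ t)
          :+ (s :- uₚ t) :* (s :* s :+ uₚ t :* uₚ t) :* (s :- (t :+ t :- 1ₚ))
          :+ s :* s :* (s :* s) :* (o :- 1ₚ))
        ≈-refl t s 1#))
    s⁸≈ : pow s 8 ≈ v * v
    s⁸≈ = trans (dropMultiple (residual 1≈)
      (solve 2 (λ s o →
          powₚ s 8 o :=
          powₚ s 4 o :* (powₚ s 4 o)
          :+ con -[1+ 0 ] :* (powₚ s 4 o :* (s :* (s :* (s :* s)))) :* (o :- 1ₚ))
        ≈-refl s 1#))
      (*-cong s⁴≈ s⁴≈)
    a≈t⁶ : a ≈ t⁶
    a≈t⁶ = trans a≈ (dropMultiple (residual 1≈)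
      (solve 2 (λ t o → powₚ t 6 o :=
          t⁶ₚ t :+ t⁶ₚ t :* (o :- 1ₚ)) ≈-refl t 1#))
    b≈t¹⁴ : b ≈ t * t * t⁶ * t⁶
    b≈t¹⁴ = trans b≈ (dropMultiple (residual 1≈)
      (solve 2 (λ t o → powₚ t 14 o :=
          t² t :* t⁶ₚ t :* t⁶ₚ t :+ t² t :* t⁶ₚ t :* t⁶ₚ t :* (o :- 1ₚ)) ≈-refl t 1#))
    root : v * w - t * t⁶ * z₁ ≈ 0#
    root = trans (dropMultiple e≈ (dropMultiple (residual l≈) (dropMultiple (residual w≈)
      (solve 5 (λ t w l e z₁ →
          uₚ t :* uₚ t :* (uₚ t :* uₚ t) :* w :- t :* t⁶ₚ t :* z₁ :=
          (t :- t)
          :+ t :* (t² t) :* errFreeₚ t e z₁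
          :+ t :* (uₚ t :* (uₚ t :* uₚ t)) :* (l :- ((t :* l :+ t :* l) :+ t :* (t :* e)))
          :+ uₚ t :* uₚ t :* (uₚ t :* uₚ t) :* (w :- t :* l))
        ≈-refl t w l e z₁))))
      (-‿inverseʳ t)

  -- The t-adic filtration, axiomatised: `Vanishes k` is meant as divisibility by t^k. Uniqueness
  -- rests on two facts, that multiplication by t raises the order and that only zero has every
  -- order.
  record Filtration (t : Carrier) : Set (Level.suc 0ℓ ⊔ c ⊔ ℓ) where
    field
      Vanishes         : ℕ → Carrier → Set
      vanishes-resp    : ∀ {k x y} → x ≈ y → Vanishes k y → Vanishes k x
      vanishes-0       : ∀ {k} → Vanishes k 0#
      vanishes-+       : ∀ {k x y} → Vanishes k x → Vanishes k y → Vanishes k (x + y)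
      vanishes-shift   : ∀ {k x} → Vanishes k x → Vanishes (suc k) (t * x)
      vanishes-weaken  : ∀ {k x} → Vanishes (suc k) x → Vanishes k x
      vanishes-start   : ∀ {x} → Vanishes 0 x
      separated        : ∀ {x} → (∀ k → Vanishes k x) → x ≈ 0#

  -- Z d plays the role of z^d, where z = t + t z²; T, M, Q, P, F, E, L count
  -- the completions of a path in the states Top, Mid, Left, Right, Base, Free,
  -- Start defined below.
  record System (t : Carrier) : Set (c ⊔ ℓ) where
    field
      Z M Q P F : ℕ → Carrier
      T E L W   : Carrier
      Z-zero : Z 0 ≈ 1′
      Z-one  : Z 1 ≈ t + t * Z 2
      Z-suc  : ∀ d → Z (suc d) ≈ t * Z d + t * Z (suc (suc d))
      T-eq   : T ≈ t + (t * T + t * T)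
      M-eq   : ∀ e → M e ≈ T + Q e
      Q-zero : Q 0 ≈ P 0
      Q-suc  : ∀ e → Q (suc e) ≈ t * Q e + P (suc e)
      P-eq   : ∀ e → P e ≈ t * P (suc e) + t * (t * M e)
      F-eq   : ∀ f → F f ≈ t * F f + (t * F (suc f) + t * P f)
      E-eq   : E ≈ t * E + (t * (t * E) + t * F 0)
      L-eq   : L ≈ (t * L + t * L) + t * (t * E)
      W-eq   : W ≈ t * L

  module _ {t : Carrier} (filtration : Filtration t) (system : System t) where
    open Filtration filtration
    open System system

    -- The order is raised for the whole family at once. Induction on the distance would fail,
    -- because the equation at distance e refers to distance e + 1.
    guarded⇒0 : {I : Set} (X : I → Carrier) →
      (∀ k → (∀ i → Vanishes k (X i)) → ∀ i → Vanishes (suc k) (X i)) →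
      ∀ i → X i ≈ 0#
    guarded⇒0 X step i = separated λ k → go k i
      where
      go : ∀ k i → Vanishes k (X i)
      go zero    i = vanishes-start
      go (suc k) i = step k (go k) i

    -- Multiplying `Z d` by `Z 1` and raising d by one both respect the walk recurrence, so the
    -- differences form a guarded family with zero boundary value. Combinatorially this is the
    -- first-passage decomposition.
    Z-square : Z 1 * Z 1 ≈ Z 2
    Z-square = x∙y⁻¹≈ε⇒x≈y _ _ (guarded⇒0 Δ step 1)
      where
      Δ : ℕ → Carrier
      Δ d = Z 1 * Z d - Z (suc d)
      step : ∀ k → (∀ d → Vanishes k (Δ d)) → ∀ d → Vanishes (suc k) (Δ d)
      step k v zero    = vanishes-resp (product-zero (Z 1) Z-zero) vanishes-0
      step k v (suc d) = vanishes-resp (product-suc t (Z 1) (Z-suc d) (Z-suc (suc d)))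
        (vanishes-+ (vanishes-shift (v d)) (vanishes-shift (v (2 ℕ.+ d))))

    -- The equation of `Q` contains `P` without a factor t, so `Q` cannot join the guarded family.
    -- Its errors get the current order from those of `P` by induction on e, and the factor t² in
    -- the equation of `P` then supplies the gain.
    right-closed : ∀ e → errRight t (P e) (Z (2 ℕ.+ e)) ≈ 0#
    right-closed = guarded⇒0 ΔP step
      where
      ΔP ΔQ : ℕ → Carrier
      ΔP e = errRight t (P e) (Z (2 ℕ.+ e))
      ΔQ e = errLeft t (Q e) (Z (1 ℕ.+ e))
      module _ (k : ℕ) (v : ∀ e → Vanishes k (ΔP e)) where
        left : ∀ e → Vanishes k (ΔQ e)
        left zero    = vanishes-resp (errLeft-zero t Q-zero Z-one) (v 0)
        left (suc e) = vanishes-resp (errLeft-suc t (Q-suc e) (Z-suc (suc e)))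
          (vanishes-+ (vanishes-weaken (vanishes-shift (left e))) (v (suc e)))
        step : ∀ e → Vanishes (suc k) (ΔP e)
        step e = vanishes-resp (errRight-step t T-eq (M-eq e) (P-eq e) (Z-suc (suc e)))
          (vanishes-+ (vanishes-shift (v (suc e)))
            (vanishes-weaken (vanishes-shift (vanishes-shift (left e)))))

    base-closed : ∀ f → errBase t (F f) (Z (2 ℕ.+ f)) (Z (3 ℕ.+ f)) ≈ 0#
    base-closed = guarded⇒0 (λ f → errBase t (F f) (Z (2 ℕ.+ f)) (Z (3 ℕ.+ f))) λ k v f →
      vanishes-resp (errBase-step t (F-eq f) (right-closed f) (Z-suc (2 ℕ.+ f)))
        (vanishes-+ (vanishes-shift (v f)) (vanishes-shift (v (suc f))))

    free-closed : errFree t E (Z 1) ≈ 0#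
    free-closed = guarded⇒0 {⊤} (λ _ → errFree t E (Z 1)) (λ k v _ →
      vanishes-resp (errFree-step t E-eq (base-closed 0) Z-one (Z-suc 1))
        (vanishes-+ (vanishes-shift (v tt))
          (vanishes-weaken (vanishes-shift (vanishes-shift (v tt)))))) tt

    quadratic : ∀ {s} (x : ℕ → Carrier) → s ≈ t + t - 1′ → 1# ≈ 1′ →
      x 0 ≈ 1# → (∀ d → x (suc d) ≈ t * x d) →
      pow s 8 * W * W - x 6 * pow s 4 * W + x 14 ≈ 0#
    quadratic {s} x s≈ 1≈ x₀ xₛ = root⇒quadratic t s s≈ 1≈ W-eq L-eq free-closed Z-one Z-square
      (powers t x x₀ xₛ 6) (powers t x x₀ xₛ 14)

-- Formal power series

open import Data.Nat using (_+_; _∸_; _<_; _≤_; z≤n; s≤s; s≤s⁻¹; _≟_; _≤?_; _≤‴_; ≤‴-refl; ≤‴-step)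
open import Data.Nat.Solver using (module +-*-Solver)
open import Data.Fin.Properties using (+↔⊎)
open import Data.Fin.Permutation using (↔⇒≡)
open import Data.List using (foldr)
open import Data.List.Properties using (map-applyUpTo; map-upTo)
open import Data.List.Relation.Unary.All as All using (All)
import Data.List.Relation.Unary.All.Properties as All
open import Data.Product using (_,_; _×_; proj₁; proj₂; ∃)
open import Data.Sum using (_⊎_; inj₁; inj₂)
open import Data.Sum.Function.Propositional using (_⊎-↔_)
open import Data.Vec using (Vec; []; _∷_)
open import Function using (_∘_)
open import Function.Construct.Composition using (_↔-∘_)
open import Function.Construct.Symmetry using (↔-sym)
open import Relation.Binary using (IsEquivalence)
open ≡.≡-Reasoning

module ℤ+ = CommutativeSemigroupProperties ℤ.+-commutativeSemigroup

infix 4 _≈_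

-- A record rather than a bare function type, so that both series can be
-- inferred from the type of an equation.
record _≈_ (f g : Series) : Set where
  constructor pointwise
  field coeff : ∀ k → f k ≡ g k

open _≈_ public

private
  tail : Series → Series
  tail f = f ∘ suc

⊛-zero : ∀ f g → (f ⊛ g) 0 ≡ f 0 ℤ.* g 0
⊛-zero f g = ℤ.+-identityʳ _

⊛-suc : ∀ f g k → (f ⊛ g) (suc k) ≡ f 0 ℤ.* g (suc k) ℤ.+ (tail f ⊛ g) k
⊛-suc f g k = cong (λ l → f 0 ℤ.* g (suc k) ℤ.+ foldr ℤ._+_ (+ 0) l)
  (≡.trans (map-applyUpTo suc (λ i → f i ℤ.* g (suc k ∸ i)) (suc k))
             (≡.sym (map-upTo (λ i → f (suc i) ℤ.* g (k ∸ i)) (suc k))))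

⊛-cong : ∀ {f f′ g g′} → f ≈ f′ → g ≈ g′ → f ⊛ g ≈ f′ ⊛ g′
⊛-cong p q = pointwise (go p q)
  where
  go : ∀ {f f′ g g′} → f ≈ f′ → g ≈ g′ → ∀ k → (f ⊛ g) k ≡ (f′ ⊛ g′) k
  go {f} {f′} {g} {g′} p q zero = begin
    (f ⊛ g) 0      ≡⟨ ⊛-zero f g ⟩
    f 0 ℤ.* g 0    ≡⟨ cong₂ ℤ._*_ (coeff p 0) (coeff q 0) ⟩
    f′ 0 ℤ.* g′ 0  ≡⟨ ⊛-zero f′ g′ ⟨
    (f′ ⊛ g′) 0    ∎
  go {f} {f′} {g} {g′} p q (suc k) = begin
    (f ⊛ g) (suc k)                            ≡⟨ ⊛-suc f g k ⟩
    f 0 ℤ.* g (suc k) ℤ.+ (tail f ⊛ g) k       ≡⟨ cong₂ ℤ._+_ (cong₂ ℤ._*_ (coeff p 0) (coeff q (suc k)))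
                                                    (go (pointwise (coeff p ∘ suc)) q k) ⟩
    f′ 0 ℤ.* g′ (suc k) ℤ.+ (tail f′ ⊛ g′) k   ≡⟨ ⊛-suc f′ g′ k ⟨
    (f′ ⊛ g′) (suc k)                          ∎

-- Commutativity exchanges the two ends of the convolution sum, so the last term has to be split off
-- as well as the first.
⊛-sucʳ : ∀ f g k → (f ⊛ g) (suc k) ≡ f (suc k) ℤ.* g 0 ℤ.+ (f ⊛ tail g) k
⊛-sucʳ f g zero = begin
  (f ⊛ g) 1                                  ≡⟨ ⊛-suc f g 0 ⟩
  f 0 ℤ.* g 1 ℤ.+ (tail f ⊛ g) 0             ≡⟨ cong (λ x → f 0 ℤ.* g 1 ℤ.+ x) (⊛-zero (tail f) g) ⟩
  f 0 ℤ.* g 1 ℤ.+ f 1 ℤ.* g 0                ≡⟨ ℤ.+-comm (f 0 ℤ.* g 1) _ ⟩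
  f 1 ℤ.* g 0 ℤ.+ f 0 ℤ.* g 1                ≡⟨ cong (λ x → f 1 ℤ.* g 0 ℤ.+ x) (⊛-zero f (tail g)) ⟨
  f 1 ℤ.* g 0 ℤ.+ (f ⊛ tail g) 0             ∎
⊛-sucʳ f g (suc k) = begin
  (f ⊛ g) (suc (suc k))                      ≡⟨ ⊛-suc f g (suc k) ⟩
  a ℤ.+ (tail f ⊛ g) (suc k)                 ≡⟨ cong (λ x → a ℤ.+ x) (⊛-sucʳ (tail f) g k) ⟩
  a ℤ.+ (b ℤ.+ (tail f ⊛ tail g) k)          ≡⟨ ℤ+.x∙yz≈y∙xz a b _ ⟩
  b ℤ.+ (a ℤ.+ (tail f ⊛ tail g) k)          ≡⟨ cong (λ x → b ℤ.+ x) (⊛-suc f (tail g) k) ⟨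
  b ℤ.+ (f ⊛ tail g) (suc k)                 ∎
  where
  a = f 0 ℤ.* g (suc (suc k))
  b = f (suc (suc k)) ℤ.* g 0

⊛-comm : ∀ f g → f ⊛ g ≈ g ⊛ f
⊛-comm f g = pointwise (go f g)
  where
  go : ∀ f g k → (f ⊛ g) k ≡ (g ⊛ f) k
  go f g zero = begin
    (f ⊛ g) 0    ≡⟨ ⊛-zero f g ⟩
    f 0 ℤ.* g 0  ≡⟨ ℤ.*-comm (f 0) (g 0) ⟩
    g 0 ℤ.* f 0  ≡⟨ ⊛-zero g f ⟨
    (g ⊛ f) 0    ∎
  go f g (suc k) = begin
    (f ⊛ g) (suc k)                       ≡⟨ ⊛-suc f g k ⟩
    f 0 ℤ.* g (suc k) ℤ.+ (tail f ⊛ g) k  ≡⟨ cong₂ ℤ._+_ (ℤ.*-comm (f 0) _) (go (tail f) g k) ⟩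
    g (suc k) ℤ.* f 0 ℤ.+ (g ⊛ tail f) k  ≡⟨ ⊛-sucʳ g f k ⟨
    (g ⊛ f) (suc k)                       ∎

⊛-distribʳ : ∀ h f g → (f ⊕ g) ⊛ h ≈ f ⊛ h ⊕ g ⊛ h
⊛-distribʳ h f g = pointwise (go f g)
  where
  go : ∀ f g k → ((f ⊕ g) ⊛ h) k ≡ (f ⊛ h) k ℤ.+ (g ⊛ h) k
  go f g zero = begin
    ((f ⊕ g) ⊛ h) 0                ≡⟨ ⊛-zero (f ⊕ g) h ⟩
    (f 0 ℤ.+ g 0) ℤ.* h 0          ≡⟨ ℤ.*-distribʳ-+ (h 0) (f 0) (g 0) ⟩
    f 0 ℤ.* h 0 ℤ.+ g 0 ℤ.* h 0    ≡⟨ cong₂ ℤ._+_ (⊛-zero f h) (⊛-zero g h) ⟨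
    (f ⊛ h) 0 ℤ.+ (g ⊛ h) 0        ∎
  go f g (suc k) = begin
    ((f ⊕ g) ⊛ h) (suc k)
      ≡⟨ ⊛-suc (f ⊕ g) h k ⟩
    (f 0 ℤ.+ g 0) ℤ.* h (suc k) ℤ.+ ((tail f ⊕ tail g) ⊛ h) k
      ≡⟨ cong₂ ℤ._+_ (ℤ.*-distribʳ-+ (h (suc k)) (f 0) (g 0)) (go (tail f) (tail g) k) ⟩
    (f 0 ℤ.* h (suc k) ℤ.+ g 0 ℤ.* h (suc k)) ℤ.+ ((tail f ⊛ h) k ℤ.+ (tail g ⊛ h) k)
      ≡⟨ ℤ+.interchange (f 0 ℤ.* h (suc k)) _ _ _ ⟩
    (f 0 ℤ.* h (suc k) ℤ.+ (tail f ⊛ h) k) ℤ.+ (g 0 ℤ.* h (suc k) ℤ.+ (tail g ⊛ h) k)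
      ≡⟨ cong₂ ℤ._+_ (⊛-suc f h k) (⊛-suc g h k) ⟨
    (f ⊛ h) (suc k) ℤ.+ (g ⊛ h) (suc k)
      ∎

⊛-scale : ∀ c f g k → ((λ i → c ℤ.* f i) ⊛ g) k ≡ c ℤ.* (f ⊛ g) k
⊛-scale c f g zero = begin
  ((λ i → c ℤ.* f i) ⊛ g) 0  ≡⟨ ⊛-zero (λ i → c ℤ.* f i) g ⟩
  c ℤ.* f 0 ℤ.* g 0          ≡⟨ ℤ.*-assoc c (f 0) (g 0) ⟩
  c ℤ.* (f 0 ℤ.* g 0)        ≡⟨ cong (c ℤ.*_) (⊛-zero f g) ⟨
  c ℤ.* (f ⊛ g) 0            ∎
⊛-scale c f g (suc k) = begin
  ((λ i → c ℤ.* f i) ⊛ g) (suc k)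
    ≡⟨ ⊛-suc (λ i → c ℤ.* f i) g k ⟩
  c ℤ.* f 0 ℤ.* g (suc k) ℤ.+ ((λ i → c ℤ.* tail f i) ⊛ g) k
    ≡⟨ cong₂ ℤ._+_ (ℤ.*-assoc c (f 0) _) (⊛-scale c (tail f) g k) ⟩
  c ℤ.* (f 0 ℤ.* g (suc k)) ℤ.+ c ℤ.* (tail f ⊛ g) k
    ≡⟨ ℤ.*-distribˡ-+ c _ _ ⟨
  c ℤ.* (f 0 ℤ.* g (suc k) ℤ.+ (tail f ⊛ g) k)
    ≡⟨ cong (c ℤ.*_) (⊛-suc f g k) ⟨
  c ℤ.* (f ⊛ g) (suc k)
    ∎

-- The tail of f ⊛ g is f₀ times the tail of g plus (tail f) ⊛ g; distributivity and scaling then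
-- reduce the claim to the tail of f.
⊛-assoc : ∀ f g h → (f ⊛ g) ⊛ h ≈ f ⊛ (g ⊛ h)
⊛-assoc f g h = pointwise (go f)
  where
  go : ∀ f k → ((f ⊛ g) ⊛ h) k ≡ (f ⊛ (g ⊛ h)) k
  go f zero = begin
    ((f ⊛ g) ⊛ h) 0              ≡⟨ ⊛-zero (f ⊛ g) h ⟩
    (f ⊛ g) 0 ℤ.* h 0            ≡⟨ cong (ℤ._* h 0) (⊛-zero f g) ⟩
    f 0 ℤ.* g 0 ℤ.* h 0          ≡⟨ ℤ.*-assoc (f 0) (g 0) (h 0) ⟩
    f 0 ℤ.* (g 0 ℤ.* h 0)        ≡⟨ cong (f 0 ℤ.*_) (⊛-zero g h) ⟨
    f 0 ℤ.* (g ⊛ h) 0            ≡⟨ ⊛-zero f (g ⊛ h) ⟨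
    (f ⊛ (g ⊛ h)) 0              ∎
  go f (suc k) = begin
    ((f ⊛ g) ⊛ h) (suc k)
      ≡⟨ ⊛-suc (f ⊛ g) h k ⟩
    (f ⊛ g) 0 ℤ.* h (suc k) ℤ.+ (tail (f ⊛ g) ⊛ h) k
      ≡⟨ cong₂ ℤ._+_ (cong (ℤ._* h (suc k)) (⊛-zero f g))
           (coeff (⊛-cong {g = h} (pointwise (⊛-suc f g)) (pointwise λ _ → refl)) k) ⟩
    f 0 ℤ.* g 0 ℤ.* h (suc k) ℤ.+ (((λ i → f 0 ℤ.* tail g i) ⊕ tail f ⊛ g) ⊛ h) k
      ≡⟨ cong₂ ℤ._+_ (ℤ.*-assoc (f 0) (g 0) _)
           (coeff (⊛-distribʳ h (λ i → f 0 ℤ.* tail g i) (tail f ⊛ g)) k) ⟩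
    f 0 ℤ.* (g 0 ℤ.* h (suc k)) ℤ.+ (((λ i → f 0 ℤ.* tail g i) ⊛ h) k ℤ.+ ((tail f ⊛ g) ⊛ h) k)
      ≡⟨ cong (λ x → f 0 ℤ.* (g 0 ℤ.* h (suc k)) ℤ.+ x)
           (cong₂ ℤ._+_ (⊛-scale (f 0) (tail g) h k) (go (tail f) k)) ⟩
    f 0 ℤ.* (g 0 ℤ.* h (suc k)) ℤ.+ (f 0 ℤ.* (tail g ⊛ h) k ℤ.+ (tail f ⊛ (g ⊛ h)) k)
      ≡⟨ ℤ.+-assoc (f 0 ℤ.* (g 0 ℤ.* h (suc k))) _ _ ⟨
    f 0 ℤ.* (g 0 ℤ.* h (suc k)) ℤ.+ f 0 ℤ.* (tail g ⊛ h) k ℤ.+ (tail f ⊛ (g ⊛ h)) k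
      ≡⟨ cong (ℤ._+ (tail f ⊛ (g ⊛ h)) k) (ℤ.*-distribˡ-+ (f 0) _ _) ⟨
    f 0 ℤ.* (g 0 ℤ.* h (suc k) ℤ.+ (tail g ⊛ h) k) ℤ.+ (tail f ⊛ (g ⊛ h)) k
      ≡⟨ cong (λ x → f 0 ℤ.* x ℤ.+ (tail f ⊛ (g ⊛ h)) k) (⊛-suc g h k) ⟨
    f 0 ℤ.* (g ⊛ h) (suc k) ℤ.+ (tail f ⊛ (g ⊛ h)) k
      ≡⟨ ⊛-suc f (g ⊛ h) k ⟨
    (f ⊛ (g ⊛ h)) (suc k)
      ∎

-- Constants and the ring of series

const : ℤ → Series
const c zero    = c
const c (suc _) = + 0

const-⊛ : ∀ c f k → (const c ⊛ f) k ≡ c ℤ.* f k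
const-⊛ c f zero    = ⊛-zero (const c) f
const-⊛ c f (suc k) = begin
  (const c ⊛ f) (suc k)                          ≡⟨ ⊛-suc (const c) f k ⟩
  c ℤ.* f (suc k) ℤ.+ ((λ _ → + 0) ⊛ f) k        ≡⟨ cong (λ x → c ℤ.* f (suc k) ℤ.+ x) (vanish k) ⟩
  c ℤ.* f (suc k) ℤ.+ + 0                        ≡⟨ ℤ.+-identityʳ _ ⟩
  c ℤ.* f (suc k)                                ∎
  where
  vanish : ∀ k → ((λ _ → + 0) ⊛ f) k ≡ + 0
  vanish k = ⊛-scale (+ 0) (λ _ → + 0) f k

𝟘 : Series
𝟘 _ = + 0

⊝_ : Series → Series
(⊝ f) k = ℤ.- f k

infix 8 ⊝_

t : Series
t = tpow 1

one≈const : ∀ k → one k ≡ const (+ 1) k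
one≈const zero    = refl
one≈const (suc _) = refl

⊛-identityˡ : ∀ f → one ⊛ f ≈ f
⊛-identityˡ f = pointwise λ k → begin
  (one ⊛ f) k            ≡⟨ coeff (⊛-cong {g = f} (pointwise one≈const) (pointwise λ _ → refl)) k ⟩
  (const (+ 1) ⊛ f) k    ≡⟨ const-⊛ (+ 1) f k ⟩
  + 1 ℤ.* f k            ≡⟨ ℤ.*-identityˡ (f k) ⟩
  f k                    ∎

≈-isEquivalence : IsEquivalence _≈_
≈-isEquivalence = record
  { refl  = pointwise λ _ → refl
  ; sym   = λ p → pointwise (≡.sym ∘ coeff p)
  ; trans = λ p q → pointwise λ k → ≡.trans (coeff p k) (coeff q k)
  }

open IsEquivalence ≈-isEquivalence public
  using () renaming (refl to ≈-refl; sym to ≈-sym; trans to ≈-trans)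

seriesRing : CommutativeRing _ _
seriesRing = record
  { Carrier = Series
  ; _≈_ = _≈_
  ; _+_ = _⊕_
  ; _*_ = _⊛_
  ; -_ = ⊝_
  ; 0# = 𝟘
  ; 1# = one
  ; isCommutativeRing = record
    { isRing = record
      { +-isAbelianGroup = record
        { isGroup = record
          { isMonoid = record
            { isSemigroup = record
              { isMagma = record
                { isEquivalence = ≈-isEquivalence
                ; ∙-cong = λ p q → pointwise λ k → cong₂ ℤ._+_ (coeff p k) (coeff q k) }
              ; assoc = λ f g h → pointwise λ k → ℤ.+-assoc (f k) (g k) (h k) }
            ; identity = (λ f → pointwise λ k → ℤ.+-identityˡ (f k))
                       , (λ f → pointwise λ k → ℤ.+-identityʳ (f k)) }
          ; inverse = (λ f → pointwise λ k → ℤ.+-inverseˡ (f k))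
                    , (λ f → pointwise λ k → ℤ.+-inverseʳ (f k))
          ; ⁻¹-cong = λ p → pointwise λ k → cong ℤ.-_ (coeff p k) }
        ; comm = λ f g → pointwise λ k → ℤ.+-comm (f k) (g k) }
      ; *-cong = ⊛-cong
      ; *-assoc = ⊛-assoc
      ; *-identity = ⊛-identityˡ , λ f → ≈-trans (⊛-comm f one) (⊛-identityˡ f)
      ; distrib = (λ h f g → ≈-trans (⊛-comm h (f ⊕ g)) (≈-trans (⊛-distribʳ h f g)
                     (pointwise λ k → cong₂ ℤ._+_ (coeff (⊛-comm f h) k) (coeff (⊛-comm g h) k))))
                , ⊛-distribʳ
      }
    ; *-comm = ⊛-comm
    }
  }

open CommutativeRing seriesRing public using ()
  renaming (+-cong to ⊕-cong; -‿cong to ⊝-cong)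

seriesACR : AlmostCommutativeRing _ _
seriesACR = fromCommutativeRing seriesRing

const-morphism : ℤ-rawRing -Raw-AlmostCommutative⟶ seriesACR
const-morphism = record
  { ⟦_⟧    = const
  ; +-homo = λ x y → pointwise λ { zero → refl ; (suc _) → refl }
  ; *-homo = λ x y → pointwise λ k → ≡.trans (times x y k) (≡.sym (const-⊛ x (const y) k))
  ; -‿homo = λ x → pointwise λ { zero → refl ; (suc _) → refl }
  ; 0-homo = pointwise λ { zero → refl ; (suc _) → refl }
  ; 1-homo = pointwise (≡.sym ∘ one≈const)
  }
  where
  times : ∀ x y k → const (x ℤ.* y) k ≡ x ℤ.* const y k
  times x y zero    = refl
  times x y (suc k) = ≡.sym (ℤ.*-zeroʳ x)

open Elimination seriesRing const-morphism using (Filtration; System; quadratic)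

-- Multiplication by t as a shift of coefficients

delay : Series → Series
delay f zero    = + 0
delay f (suc k) = f k

tpow-suc : ∀ d k → tpow (suc d) (suc k) ≡ tpow d k
tpow-suc d k with d ≟ k | suc d ≟ suc k
... | yes _   | yes _    = refl
... | no _    | no _     = refl
... | yes d≡k | no d≢k   = contradiction (cong suc d≡k) d≢k
... | no d≢k  | yes d≡k  = contradiction (ℕ.suc-injective d≡k) d≢k

t⊛≈delay : ∀ f → t ⊛ f ≈ delay f
t⊛≈delay f = pointwise λ where
    zero    → ⊛-zero t f
    (suc k) → ≡.trans (⊛-suc t f k)
      (≡.trans (ℤ.+-identityˡ _)
        (≡.trans (coeff (⊛-cong {g = f} (pointwise (tpow-suc 0)) ≈-refl) k)
                 (coeff (⊛-identityˡ f) k)))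

delay-tpow : ∀ d → delay (tpow d) ≈ tpow (suc d)
delay-tpow d = pointwise λ where
  zero    → refl
  (suc k) → ≡.sym (tpow-suc d k)

delay-cong : ∀ {f g} → f ≈ g → delay f ≈ delay g
delay-cong p = pointwise λ where
  zero    → refl
  (suc k) → coeff p k

t²⊛≈delay² : ∀ f → t ⊛ (t ⊛ f) ≈ delay (delay f)
t²⊛≈delay² f = ≈-trans (t⊛≈delay (t ⊛ f)) (delay-cong (t⊛≈delay f))

Vanishes : ℕ → Series → Set
Vanishes k f = ∀ i → i < k → f i ≡ + 0

vanishes-t⊛ : ∀ {k f} → Vanishes k f → Vanishes (suc k) (t ⊛ f)
vanishes-t⊛ {f = f} v zero    _         = ⊛-zero t f
vanishes-t⊛ {f = f} v (suc i) (s≤s i<k) = ≡.trans (coeff (t⊛≈delay f) (suc i)) (v i i<k)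

tpow-suc≈ : ∀ d → tpow (suc d) ≈ t ⊛ tpow d
tpow-suc≈ d = ≈-trans (≈-sym (delay-tpow d)) (≈-sym (t⊛≈delay (tpow d)))

-- The unit-step recurrences

-- Coefficients count walks on ℕ with steps ±1 from d that first reach 0 at time k.
Z : ℕ → Series
Z zero    zero    = + 1
Z zero    (suc k) = + 0
Z (suc d) zero    = + 0
Z (suc d) (suc k) = Z d k ℤ.+ Z (suc (suc d)) k

Z-zero : Z 0 ≈ const (+ 1)
Z-zero = pointwise λ where
  zero    → refl
  (suc _) → refl

Z-suc : ∀ d → Z (suc d) ≈ t ⊛ Z d ⊕ t ⊛ Z (suc (suc d))
Z-suc d = ≈-trans
  (pointwise λ where
    zero    → refl
    (suc k) → refl)
  (≈-sym (⊕-cong (t⊛≈delay (Z d)) (t⊛≈delay (Z (2 + d)))))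

Z-one : Z 1 ≈ t ⊕ t ⊛ Z 2
Z-one = ≈-trans
  (pointwise λ where
    zero          → refl
    (suc zero)    → refl
    (suc (suc k)) → refl)
  (⊕-cong {t} ≈-refl (≈-sym (t⊛≈delay (Z 2))))

#top : ℕ → ℕ
#top zero          = 0
#top (suc zero)    = 1
#top (suc (suc p)) = #top (suc p) + #top (suc p)

-- No column `y` occurs: translating these paths horizontally preserves their cost. The coefficients
-- 0 and 1 of `#right` are separate clauses because completing a hole row costs two.
#mid #left #right : ℕ → ℕ → ℕ
#mid e p = #top p + #left e p
#left zero    p       = #right 0 p
#left (suc e) zero    = #right (suc e) 0
#left (suc e) (suc p) = #left e p + #right (suc e) (suc p)
#right e zero          = 0
#right e (suc zero)    = #right (suc e) 0
#right e (suc (suc p)) = #right (suc e) (suc p) + #mid e p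

#base : ℕ → ℕ → ℕ
#base f zero    = 0
#base f (suc p) = #base f p + (#base (suc f) p + #right f p)

#free : ℕ → ℕ
#free zero          = 0
#free (suc zero)    = #free 0 + #base 0 0
#free (suc (suc p)) = #free (suc p) + (#free p + #base 0 (suc p))

#start : ℕ → ℕ
#start zero          = 0
#start (suc zero)    = #start 0 + #start 0
#start (suc (suc p)) = #start (suc p) + #start (suc p) + #free p

#wfd : ℕ → ℕ
#wfd zero    = 0
#wfd (suc p) = #start p

T-eq : series #top ≈ t ⊕ (t ⊛ series #top ⊕ t ⊛ series #top)
T-eq = ≈-trans
  (pointwise λ where
    zero          → refl
    (suc zero)    → refl
    (suc (suc p)) → refl)
  (⊕-cong {t} ≈-refl (≈-sym (⊕-cong (t⊛≈delay (series #top)) (t⊛≈delay (series #top)))))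

M Q P F : ℕ → Series
M e = series (#mid e)
Q e = series (#left e)
P e = series (#right e)
F f = series (#base f)

M-eq : ∀ e → M e ≈ series #top ⊕ Q e
M-eq e = pointwise λ p → refl

Q-zero : Q 0 ≈ P 0
Q-zero = pointwise λ p → refl

Q-suc : ∀ e → Q (suc e) ≈ t ⊛ Q e ⊕ P (suc e)
Q-suc e = ≈-trans
  (pointwise λ where
    zero    → refl
    (suc p) → refl)
  (⊕-cong (≈-sym (t⊛≈delay (Q e))) ≈-refl)

P-eq : ∀ e → P e ≈ t ⊛ P (suc e) ⊕ t ⊛ (t ⊛ M e)
P-eq e = ≈-trans
  (pointwise λ where
    zero          → refl
    (suc zero)    → refl
    (suc (suc p)) → refl)
  (≈-sym (⊕-cong (t⊛≈delay (P (suc e))) (t²⊛≈delay² (M e))))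

F-eq : ∀ f → F f ≈ t ⊛ F f ⊕ (t ⊛ F (suc f) ⊕ t ⊛ P f)
F-eq f = ≈-trans
  (pointwise λ where
    zero    → refl
    (suc p) → refl)
  (≈-sym (⊕-cong (t⊛≈delay (F f)) (⊕-cong (t⊛≈delay (F (suc f))) (t⊛≈delay (P f)))))

E-eq : series #free ≈ t ⊛ series #free ⊕ (t ⊛ (t ⊛ series #free) ⊕ t ⊛ F 0)
E-eq = ≈-trans
  (pointwise λ where
    zero          → refl
    (suc zero)    → refl
    (suc (suc p)) → refl)
  (≈-sym (⊕-cong (t⊛≈delay (series #free)) (⊕-cong (t²⊛≈delay² (series #free)) (t⊛≈delay (F 0)))))

L-eq : series #start ≈ (t ⊛ series #start ⊕ t ⊛ series #start) ⊕ t ⊛ (t ⊛ series #free)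
L-eq = ≈-trans
  (pointwise λ where
    zero          → refl
    (suc zero)    → refl
    (suc (suc p)) → refl)
  (≈-sym (⊕-cong (⊕-cong (t⊛≈delay (series #start)) (t⊛≈delay (series #start))) (t²⊛≈delay² (series #free))))

W-eq : series #wfd ≈ t ⊛ series #start
W-eq = ≈-trans
  (pointwise λ where
    zero    → refl
    (suc p) → refl)
  (≈-sym (t⊛≈delay (series #start)))

filtration : Filtration t
filtration = record
  { Vanishes        = Vanishes
  ; vanishes-resp   = λ p v i i<k → ≡.trans (coeff p i) (v i i<k)
  ; vanishes-0      = λ _ _ → refl
  ; vanishes-+      = λ v w i i<k → cong₂ ℤ._+_ (v i i<k) (w i i<k)
  ; vanishes-shift  = vanishes-t⊛
  ; vanishes-weaken = λ v i i<k → v i (ℕ.m<n⇒m<1+n i<k)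
  ; vanishes-start  = λ _ ()
  ; separated       = λ v → pointwise λ k → v (suc k) k ℕ.≤-refl
  }

system : System t
system = record
  { Z = Z ; M = M ; Q = Q ; P = P ; F = F
  ; T = series #top ; E = series #free ; L = series #start ; W = series #wfd
  ; Z-zero = Z-zero ; Z-one = Z-one ; Z-suc = Z-suc
  ; T-eq = T-eq ; M-eq = M-eq ; Q-zero = Q-zero ; Q-suc = Q-suc ; P-eq = P-eq
  ; F-eq = F-eq ; E-eq = E-eq ; L-eq = L-eq ; W-eq = W-eq
  }

2t-1≈ : 2t-1 ≈ t ⊕ t ⊕ ⊝ const (+ 1)
2t-1≈ = pointwise λ where
  zero          → refl
  (suc zero)    → refl
  (suc (suc k)) → refl

#wfd-quadratic : (2t-1 ^^ 8) ⊛ series #wfd ⊛ series #wfd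
  ⊖ tpow 6 ⊛ (2t-1 ^^ 4) ⊛ series #wfd ⊕ tpow 14 ≈ 𝟘
#wfd-quadratic = quadratic filtration system tpow 2t-1≈ (pointwise one≈const) ≈-refl tpow-suc≈

-- A diagram is traced from the bottom by unit steps, the last index being
-- the half-perimeter still to come. A step right widens the current row, a
-- step up completes it. In Mid, Left and Right the hole ends at column y and
-- the current row at column e + y + 1; Mid follows a completed hole row,
-- Left moves the end of the hole and Right the end of the row. In Base the
-- hole's first end y is already passed, in Free the current width a is beyond
-- ℓ but not beyond y, in Start it is at most ℓ. A step costs two if it crosses
-- one of the columns ℓ + 1, …, y, which count for m_N and for g_n - ℓ, or if
-- it completes a hole row, which counts for N and for n - j.
UpperShape Shape : Set₁
UpperShape = (n N : ℕ) → Vec ℕ N → Vec ℕ n → ℕ → Set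
Shape      = (j n N : ℕ) → Vec ℕ N → Vec ℕ (n ∸ j) → ℕ → Set

data Top (b : ℕ) : UpperShape where
  end   : Top b 0 1 (b ∷ []) [] 1
  up    : ∀ {n N m g p} → Top b n N m g p → Top b n (suc N) (b ∷ m) g (suc p)
  right : ∀ {n N m g p} → Top (suc b) n N m g p → Top b n N m g (suc p)

mutual
  data Mid (y e : ℕ) : UpperShape where
    fin  : ∀ {n N m g p} → Top (suc (e + y)) n N m g p → Mid y e n N m g p
    more : ∀ {n N m g p} → Left y e n N m g p → Mid y e n N m g p

  -- The hole moves before the row is widened, because the next hole end is bounded by the length of
  -- the row below; e is the room that this bound leaves.
  data Left (y : ℕ) : ℕ → UpperShape where
    shift : ∀ {e n N m g p} → Left (suc y) e n N m g p → Left y (suc e) n N m g (suc p)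
    stop  : ∀ {e n N m g p} → Right y e n N m g p → Left y e n N m g p

  data Right (y e : ℕ) : UpperShape where
    right : ∀ {n N m g p} → Right y (suc e) n N m g p → Right y e n N m g (suc p)
    up    : ∀ {n N m g p} → Mid y e n N m g p →
            Right y e (suc n) (suc N) (suc (e + y) ∷ m) (y ∷ g) (suc (suc p))

-- `up` raises j and n together, so `n ∸ j`, and with it the type of `g`, is unchanged by
-- computation. The length `suc (f + y)` in `last` enforces that row j extends beyond the first hole
-- end.
data Base (y f : ℕ) : Shape where
  up    : ∀ {j n N m g p} → Base y f j n N m g p →
          Base y f (suc j) (suc n) (suc N) (suc (f + y) ∷ m) g (suc p)
  right : ∀ {j n N m g p} → Base y (suc f) j n N m g p → Base y f j n N m g (suc p)
  last  : ∀ {n N m g p} → Right y f n N m g p →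
          Base y f 1 (suc n) (suc N) (suc (f + y) ∷ m) g (suc p)

data Free (a : ℕ) : Shape where
  up    : ∀ {j n N m g p} → Free a j n N m g p →
          Free a (suc j) (suc n) (suc N) (a ∷ m) g (suc p)
  right : ∀ {j n N m g p} → Free (suc a) j n N m g p → Free a j n N m g (suc (suc p))
  next  : ∀ {j n N m g p} → Base a 0 j n N m g p → Free a j n N m g (suc p)

data Start (a : ℕ) : ℕ → Shape where
  up    : ∀ {ℓ j n N m g p} → Start a ℓ j n N m g p →
          Start a ℓ (suc j) (suc n) (suc N) (a ∷ m) g (suc p)
  right : ∀ {ℓ j n N m g p} → Start (suc a) ℓ j n N m g p → Start a ℓ j n N m g (suc p)
  next  : ∀ {j n N m g p} → Free (suc a) j n N m g p → Start a a j n N m g (suc (suc p))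

-- Counting paths

record Upper (X : UpperShape) (p : ℕ) : Set where
  constructor tot
  field
    {n N} : ℕ
    {m} : Vec ℕ N
    {g} : Vec ℕ n
    path : X n N m g p

record Total (X : Shape) (p : ℕ) : Set where
  constructor tot
  field
    {j n N} : ℕ
    {m} : Vec ℕ N
    {g} : Vec ℕ (n ∸ j)
    path : X j n N m g p

record Totalℓ (X : ℕ → Shape) (p : ℕ) : Set where
  constructor tot
  field
    {ℓ j n N} : ℕ
    {m} : Vec ℕ N
    {g} : Vec ℕ (n ∸ j)
    path : X ℓ j n N m g p

module _ {A B : Set} {a b : ℕ} where
  infixr 1 _⊕↔_
  _⊕↔_ : Fin a ↔ A → Fin b ↔ B → Fin (a + b) ↔ (A ⊎ B)
  f ⊕↔ g = (f ⊎-↔ g) ↔-∘ +↔⊎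

Fin0↔ : {A : Set} → (A → Fin 0) → Fin 0 ↔ A
Fin0↔ f = mk↔ₛ′ (λ ()) f (λ x → contradiction (f x) λ ()) (λ ())

top↔ : ∀ p b → Fin (#top p) ↔ Upper (Top b) p
top↔ zero b = Fin0↔ λ { (tot ()) }
top↔ (suc zero) b = mk↔ₛ′ (λ _ → tot end) (λ _ → Fin.zero)
    (λ { (tot end) → refl ; (tot (up ())) ; (tot (right ())) }) (λ { Fin.zero → refl ; (Fin.suc ()) })
top↔ (suc (suc p)) b = step ↔-∘ (top↔ (suc p) b ⊕↔ top↔ (suc p) (suc b))
  where
  step : (Upper (Top b) (suc p) ⊎ Upper (Top (suc b)) (suc p)) ↔ Upper (Top b) (suc (suc p))
  step = mk↔ₛ′
    (λ { (inj₁ (tot d)) → tot (up d) ; (inj₂ (tot d)) → tot (right d) })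
    (λ { (tot (up d)) → inj₁ (tot d) ; (tot (right d)) → inj₂ (tot d) })
    (λ { (tot (up d)) → refl ; (tot (right d)) → refl })
    (λ { (inj₁ (tot d)) → refl ; (inj₂ (tot d)) → refl })

mid↔   : ∀ p y e → Fin (#mid e p)   ↔ Upper (Mid y e) p
left↔  : ∀ p y e → Fin (#left e p)  ↔ Upper (Left y e) p
right↔ : ∀ p y e → Fin (#right e p) ↔ Upper (Right y e) p

mid↔ p y e = step ↔-∘ (top↔ p (suc (e + y)) ⊕↔ left↔ p y e)
  where
  step : (Upper (Top (suc (e + y))) p ⊎ Upper (Left y e) p) ↔ Upper (Mid y e) p
  step = mk↔ₛ′
    (λ { (inj₁ (tot d)) → tot (fin d) ; (inj₂ (tot d)) → tot (more d) })
    (λ { (tot (fin d)) → inj₁ (tot d) ; (tot (more d)) → inj₂ (tot d) })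
    (λ { (tot (fin d)) → refl ; (tot (more d)) → refl })
    (λ { (inj₁ (tot d)) → refl ; (inj₂ (tot d)) → refl })

left↔ p y zero = step ↔-∘ right↔ p y 0
  where
  step : Upper (Right y 0) p ↔ Upper (Left y 0) p
  step = mk↔ₛ′ (λ { (tot d) → tot (stop d) }) (λ { (tot (stop d)) → tot d })
    (λ { (tot (stop d)) → refl }) (λ { (tot d) → refl })
left↔ zero y (suc e) = Fin0↔ λ { (tot (stop ())) }
left↔ (suc p) y (suc e) = step ↔-∘ (left↔ p (suc y) e ⊕↔ right↔ (suc p) y (suc e))
  where
  step : (Upper (Left (suc y) e) p ⊎ Upper (Right y (suc e)) (suc p)) ↔ Upper (Left y (suc e)) (suc p)
  step = mk↔ₛ′
    (λ { (inj₁ (tot d)) → tot (shift d) ; (inj₂ (tot d)) → tot (stop d) })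
    (λ { (tot (shift d)) → inj₁ (tot d) ; (tot (stop d)) → inj₂ (tot d) })
    (λ { (tot (shift d)) → refl ; (tot (stop d)) → refl })
    (λ { (inj₁ (tot d)) → refl ; (inj₂ (tot d)) → refl })

right↔ zero y e = Fin0↔ λ { (tot ()) }
right↔ (suc zero) y e = Fin0↔ λ { (tot (right ())) }
right↔ (suc (suc p)) y e = step ↔-∘ (right↔ (suc p) y (suc e) ⊕↔ mid↔ p y e)
  where
  step : (Upper (Right y (suc e)) (suc p) ⊎ Upper (Mid y e) p) ↔ Upper (Right y e) (suc (suc p))
  step = mk↔ₛ′
    (λ { (inj₁ (tot d)) → tot (right d) ; (inj₂ (tot d)) → tot (up d) })
    (λ { (tot (right d)) → inj₁ (tot d) ; (tot (up d)) → inj₂ (tot d) })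
    (λ { (tot (right d)) → refl ; (tot (up d)) → refl })
    (λ { (inj₁ (tot d)) → refl ; (inj₂ (tot d)) → refl })

base↔ : ∀ p y f → Fin (#base f p) ↔ Total (Base y f) p
base↔ zero    y f = Fin0↔ λ { (tot ()) }
base↔ (suc p) y f = step ↔-∘ (base↔ p y f ⊕↔ (base↔ p y (suc f) ⊕↔ right↔ p y f))
  where
  step : (Total (Base y f) p ⊎ (Total (Base y (suc f)) p ⊎ Upper (Right y f) p)) ↔ Total (Base y f) (suc p)
  step = mk↔ₛ′
    (λ { (inj₁ (tot d)) → tot (up d) ; (inj₂ (inj₁ (tot d))) → tot (right d)
       ; (inj₂ (inj₂ (tot d))) → tot (last d) })
    (λ { (tot (up d)) → inj₁ (tot d) ; (tot (right d)) → inj₂ (inj₁ (tot d))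
       ; (tot (last d)) → inj₂ (inj₂ (tot d)) })
    (λ { (tot (up d)) → refl ; (tot (right d)) → refl ; (tot (last d)) → refl })
    (λ { (inj₁ (tot d)) → refl ; (inj₂ (inj₁ (tot d))) → refl ; (inj₂ (inj₂ (tot d))) → refl })

free↔ : ∀ p a → Fin (#free p) ↔ Total (Free a) p
free↔ zero          a = Fin0↔ λ { (tot ()) }
free↔ (suc zero)    a = Fin0↔ λ { (tot (up ())) ; (tot (next ())) }
free↔ (suc (suc p)) a = step ↔-∘ (free↔ (suc p) a ⊕↔ (free↔ p (suc a) ⊕↔ base↔ (suc p) a 0))
  where
  step : (Total (Free a) (suc p) ⊎ (Total (Free (suc a)) p ⊎ Total (Base a 0) (suc p))) ↔ Total (Free a) (suc (suc p))
  step = mk↔ₛ′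
    (λ { (inj₁ (tot d)) → tot (up d) ; (inj₂ (inj₁ (tot d))) → tot (right d)
       ; (inj₂ (inj₂ (tot d))) → tot (next d) })
    (λ { (tot (up d)) → inj₁ (tot d) ; (tot (right d)) → inj₂ (inj₁ (tot d))
       ; (tot (next d)) → inj₂ (inj₂ (tot d)) })
    (λ { (tot (up d)) → refl ; (tot (right d)) → refl ; (tot (next d)) → refl })
    (λ { (inj₁ (tot d)) → refl ; (inj₂ (inj₁ (tot d))) → refl ; (inj₂ (inj₂ (tot d))) → refl })

start↔ : ∀ p a → Fin (#start p) ↔ Totalℓ (Start a) p
start↔ zero          a = Fin0↔ λ { (tot ()) }
start↔ (suc zero)    a = Fin0↔ λ { (tot (up ())) ; (tot (right ())) }
start↔ (suc (suc p)) a = step ↔-∘ ((start↔ (suc p) a ⊕↔ start↔ (suc p) (suc a)) ⊕↔ free↔ p (suc a))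
  where
  step : ((Totalℓ (Start a) (suc p) ⊎ Totalℓ (Start (suc a)) (suc p)) ⊎ Total (Free (suc a)) p)
         ↔ Totalℓ (Start a) (suc (suc p))
  step = mk↔ₛ′
    (λ { (inj₁ (inj₁ (tot d))) → tot (up d) ; (inj₁ (inj₂ (tot d))) → tot (right d)
       ; (inj₂ (tot d)) → tot (next d) })
    (λ { (tot (up d)) → inj₁ (inj₁ (tot d)) ; (tot (right d)) → inj₁ (inj₂ (tot d))
       ; (tot (next d)) → inj₂ (tot d) })
    (λ { (tot (up d)) → refl ; (tot (right d)) → refl ; (tot (next d)) → refl })
    (λ { (inj₁ (inj₁ (tot d))) → refl ; (inj₁ (inj₂ (tot d))) → refl ; (inj₂ (tot d)) → refl })

-- Bounds on the rows and hole ends produced by a path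

top-n : ∀ {b n N m g p} → Top b n N m g p → n ≡ 0
top-n end       = refl
top-n (up d)    = top-n d
top-n (right d) = top-n d

top-N : ∀ {b n N m g p} → Top b n N m g p → 0 < N
top-N end       = s≤s z≤n
top-N (up d)    = s≤s z≤n
top-N (right d) = top-N d

mid-N   : ∀ {y e n N m g p} → Mid y e n N m g p → n < N
left-N  : ∀ {y e n N m g p} → Left y e n N m g p → n < N
right-N : ∀ {y e n N m g p} → Right y e n N m g p → n < N
mid-N (fin d) rewrite top-n d = top-N d
mid-N (more d)    = left-N d
left-N (shift d)  = left-N d
left-N (stop d)   = right-N d
right-N (right d) = right-N d
right-N (up d)    = s≤s (mid-N d)

right-n : ∀ {y e n N m g p} → Right y e n N m g p → 0 < n
right-n (right d) = right-n d
right-n (up d)    = s≤s z≤n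

left-n : ∀ {y e n N m g p} → Left y e n N m g p → 0 < n
left-n (shift d) = left-n d
left-n (stop d)  = right-n d

base-N : ∀ {y f j n N m g p} → Base y f j n N m g p → n < N
base-N (up d)    = s≤s (base-N d)
base-N (right d) = base-N d
base-N (last d)  = s≤s (right-N d)

free-N : ∀ {a j n N m g p} → Free a j n N m g p → n < N
free-N (up d)    = s≤s (free-N d)
free-N (right d) = free-N d
free-N (next d)  = base-N d

start-N : ∀ {a ℓ j n N m g p} → Start a ℓ j n N m g p → n < N
start-N (up d)    = s≤s (start-N d)
start-N (right d) = start-N d
start-N (next d)  = free-N d

base-j : ∀ {y f j n N m g p} → Base y f j n N m g p → 0 < j × j < n
base-j (up d)    = s≤s z≤n , s≤s (proj₂ (base-j d))
base-j (right d) = base-j d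
base-j (last d)  = s≤s z≤n , s≤s (right-n d)

free-j : ∀ {a j n N m g p} → Free a j n N m g p → 0 < j × j < n
free-j (up d)    = s≤s z≤n , s≤s (proj₂ (free-j d))
free-j (right d) = free-j d
free-j (next d)  = base-j d

start-j : ∀ {a ℓ j n N m g p} → Start a ℓ j n N m g p → 0 < j × j < n
start-j (up d)    = s≤s z≤n , s≤s (proj₂ (start-j d))
start-j (right d) = start-j d
start-j (next d)  = free-j d

-- The next completed row reveals the first step: it equals the current width if that step completes
-- it, and is strictly longer after `right`. The analogues below serve the same purpose.
top-m : ∀ {b n N m g p} → Top b n N m g p → b ≤ at m 1
top-m end       = ℕ.≤-refl
top-m (up d)    = ℕ.≤-refl
top-m (right d) = ℕ.<⇒≤ (top-m d)

right-m : ∀ {y e n N m g p} → Right y e n N m g p → suc (e + y) ≤ at m 1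
right-m (right d) = ℕ.<⇒≤ (right-m d)
right-m (up d)    = ℕ.≤-refl

base-m : ∀ {y f j n N m g p} → Base y f j n N m g p → suc (f + y) ≤ at m 1
base-m (up d)    = ℕ.≤-refl
base-m (right d) = ℕ.<⇒≤ (base-m d)
base-m (last d)  = ℕ.≤-refl

free-m : ∀ {a j n N m g p} → Free a j n N m g p → a ≤ at m 1
free-m (up d)    = ℕ.≤-refl
free-m (right d) = ℕ.<⇒≤ (free-m d)
free-m (next d)  = ℕ.<⇒≤ (base-m d)

start-m : ∀ {a ℓ j n N m g p} → Start a ℓ j n N m g p → a ≤ at m 1
start-m (up d)    = ℕ.≤-refl
start-m (right d) = ℕ.<⇒≤ (start-m d)
start-m (next d)  = ℕ.<⇒≤ (free-m d)

-- The hole end is frozen in `Right` but exceeds y after a `shift`; this tells `stop` from `shift`.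
right-g : ∀ {y e n N m g p} → Right y e n N m g p → at g 1 ≡ y
right-g (right d) = right-g d
right-g (up d)    = refl

left-g : ∀ {y e n N m g p} → Left y e n N m g p → y ≤ at g 1
left-g (shift d) = ℕ.<⇒≤ (left-g d)
left-g (stop d)  = ℕ.≤-reflexive (≡.sym (right-g d))

base-g : ∀ {y f j n N m g p} → Base y f j n N m g p → at g 1 ≡ y
base-g (up d)    = base-g d
base-g (right d) = base-g d
base-g (last d)  = right-g d

free-g : ∀ {a j n N m g p} → Free a j n N m g p → a ≤ at g 1
free-g (up d)    = free-g d
free-g (right d) = ℕ.<⇒≤ (free-g d)
free-g (next d)  = ℕ.≤-reflexive (≡.sym (base-g d))

start-ℓ : ∀ {a ℓ j n N m g p} → Start a ℓ j n N m g p → a ≤ ℓ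
start-ℓ (up d)    = start-ℓ d
start-ℓ (right d) = ℕ.<⇒≤ (start-ℓ d)
start-ℓ (next d)  = ℕ.≤-refl

-- A path is determined by its diagram

top-unique : ∀ {b n N m g p} (c d : Top b n N m g p) → c ≡ d
top-unique end        end        = refl
top-unique end        (up ())
top-unique end        (right ())
top-unique (up ())    end
top-unique (right ()) end
top-unique (up c)     (up d)     = cong up (top-unique c d)
top-unique (right c)  (right d)  = cong right (top-unique c d)
top-unique (up _)     (right d)  = contradiction (top-m d) ℕ.1+n≰n
top-unique (right c)  (up _)     = contradiction (top-m c) ℕ.1+n≰n

mid-unique   : ∀ {y e n N m g p} (c d : Mid y e n N m g p) → c ≡ d
left-unique  : ∀ {y e n N m g p} (c d : Left y e n N m g p) → c ≡ d
right-unique : ∀ {y e n N m g p} (c d : Right y e n N m g p) → c ≡ d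
mid-unique (fin c)  (fin d)  = cong fin (top-unique c d)
mid-unique (more c) (more d) = cong more (left-unique c d)
mid-unique (fin c)  (more d) = contradiction (top-n c) (ℕ.>⇒≢ (left-n d))
mid-unique (more c) (fin d)  = contradiction (top-n d) (ℕ.>⇒≢ (left-n c))
left-unique (shift c) (shift d) = cong shift (left-unique c d)
left-unique (stop c)  (stop d)  = cong stop (right-unique c d)
left-unique (shift c) (stop d)  = contradiction (right-g d) (ℕ.>⇒≢ (left-g c))
left-unique (stop c)  (shift d) = contradiction (right-g c) (ℕ.>⇒≢ (left-g d))
right-unique (right c) (right d) = cong right (right-unique c d)
right-unique (up c)    (up d)    = cong up (mid-unique c d)
right-unique (right c) (up d)    = contradiction (right-m c) ℕ.1+n≰n
right-unique (up c)    (right d) = contradiction (right-m d) ℕ.1+n≰n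

base-unique : ∀ {y f j n N m g p} (c d : Base y f j n N m g p) → c ≡ d
base-unique (up c)    (up d)    = cong up (base-unique c d)
base-unique (right c) (right d) = cong right (base-unique c d)
base-unique (last c)  (last d)  = cong last (right-unique c d)
base-unique (up _)    (right d) = contradiction (base-m d) ℕ.1+n≰n
base-unique (last _)  (right d) = contradiction (base-m d) ℕ.1+n≰n
base-unique (right c) (up _)    = contradiction (base-m c) ℕ.1+n≰n
base-unique (right c) (last _)  = contradiction (base-m c) ℕ.1+n≰n
base-unique (up c)    (last _)  = contradiction (proj₁ (base-j c)) ℕ.1+n≰n
base-unique (last _)  (up d)    = contradiction (proj₁ (base-j d)) ℕ.1+n≰n

free-unique : ∀ {a j n N m g p} (c d : Free a j n N m g p) → c ≡ d
free-unique (up c)    (up d)    = cong up (free-unique c d)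
free-unique (right c) (right d) = cong right (free-unique c d)
free-unique (next c)  (next d)  = cong next (base-unique c d)
free-unique (up _)    (right d) = contradiction (free-m d) ℕ.1+n≰n
free-unique (up _)    (next d)  = contradiction (base-m d) ℕ.1+n≰n
free-unique (right c) (up _)    = contradiction (free-m c) ℕ.1+n≰n
free-unique (next c)  (up _)    = contradiction (base-m c) ℕ.1+n≰n
free-unique (right c) (next d)  = contradiction (base-g d) (ℕ.>⇒≢ (free-g c))
free-unique (next c)  (right d) = contradiction (base-g c) (ℕ.>⇒≢ (free-g d))

start-unique : ∀ {a ℓ j n N m g p} (c d : Start a ℓ j n N m g p) → c ≡ d
start-unique (up c)    (up d)    = cong up (start-unique c d)
start-unique (right c) (right d) = cong right (start-unique c d)
start-unique (next c)  (next d)  = cong next (free-unique c d)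
start-unique (up _)    (right d) = contradiction (start-m d) ℕ.1+n≰n
start-unique (up _)    (next d)  = contradiction (free-m d) ℕ.1+n≰n
start-unique (right c) (up _)    = contradiction (start-m c) ℕ.1+n≰n
start-unique (next c)  (up _)    = contradiction (free-m c) ℕ.1+n≰n
start-unique (right c) (next _)  = contradiction (start-ℓ c) ℕ.1+n≰n
start-unique (next _)  (right d) = contradiction (start-ℓ d) ℕ.1+n≰n

-- a is the length of the row below, h a lower bound for the next hole end.
data Rows (a h : ℕ) : (j n N : ℕ) → Vec ℕ N → Vec ℕ (n ∸ j) → Set where
  nil : Rows a h 0 0 0 [] []
  top : ∀ {x N m} → a ≤ x → Rows x h 0 0 N m [] → Rows a h 0 0 (suc N) (x ∷ m) []
  mid : ∀ {x z n N m g} → a ≤ x → h ≤ z → z < a → Rows x z 0 n N m g →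
        Rows a h 0 (suc n) (suc N) (x ∷ m) (z ∷ g)
  bot : ∀ {x j n N m g} → a ≤ x → Rows x h j n N m g → Rows a h (suc j) (suc n) (suc N) (x ∷ m) g

lower-h : ∀ {a h h′ j n N m g} → h′ ≤ h → Rows a h j n N m g → Rows a h′ j n N m g
lower-h h′≤h nil                   = nil
lower-h h′≤h (top a≤x r)           = top a≤x (lower-h h′≤h r)
lower-h h′≤h (mid a≤x h≤z z<a r)   = mid a≤x (ℕ.≤-trans h′≤h h≤z) z<a r
lower-h h′≤h (bot a≤x r)           = bot a≤x (lower-h h′≤h r)

-- The row below bounds the next row from below but the next hole end from above. Shortening it is
-- therefore harmless except when a hole row comes next, which is the case the side condition
-- covers.
lower-a : ∀ {a a′ h j n N m g} → a′ ≤ a → (j ≡ 0 → 0 < n → at g 1 < a′) →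
  Rows a h j n N m g → Rows a′ h j n N m g
lower-a a′≤a _ nil                 = nil
lower-a a′≤a _ (top a≤x r)         = top (ℕ.≤-trans a′≤a a≤x) r
lower-a a′≤a z<a′ (mid a≤x h≤z _ r) = mid (ℕ.≤-trans a′≤a a≤x) h≤z (z<a′ refl (s≤s z≤n)) r
lower-a a′≤a _ (bot a≤x r)         = bot (ℕ.≤-trans a′≤a a≤x) r

top-rows : ∀ {b h N m p} → Top b 0 N m [] p → Rows b h 0 0 N m []
top-rows end       = top ℕ.≤-refl nil
top-rows (up d)    = top ℕ.≤-refl (top-rows d)
top-rows (right d) = lower-a (ℕ.n≤1+n _) (λ _ ()) (top-rows d)

mid-rows   : ∀ {y e n N m g p} → Mid y e n N m g p → Rows (suc (e + y)) y 0 n N m g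
left-rows  : ∀ {y e n N m g p} → Left y e n N m g p → Rows (suc (e + y)) y 0 n N m g
right-rows : ∀ {y e n N m g p} → Right y e n N m g p → Rows (suc (e + y)) y 0 n N m g
mid-rows {n = zero} {g = []} (fin d) = top-rows d
mid-rows {n = suc _} (fin d) = contradiction (top-n d) λ ()
mid-rows (more d) = left-rows d
left-rows {y} {suc e} {n} {N} {m} {g} (shift d) =
  lower-h (ℕ.n≤1+n _) (≡.subst (λ k → Rows (suc k) (suc y) 0 n N m g) (ℕ.+-suc e y) (left-rows d))
left-rows (stop d) = right-rows d
right-rows {y} {e} (right d) = lower-a (ℕ.n≤1+n _)
  (λ _ _ → ℕ.≤-trans (s≤s (ℕ.≤-reflexive (right-g d))) (s≤s (ℕ.m≤n+m y e))) (right-rows d)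
right-rows {y} {e} (up d) = mid ℕ.≤-refl ℕ.≤-refl (s≤s (ℕ.m≤n+m y e)) (mid-rows d)

base-rows : ∀ {y f j n N m g p} → Base y f j n N m g p → Rows (suc (f + y)) y j n N m g
base-rows (up d)    = bot ℕ.≤-refl (base-rows d)
base-rows (right d) = lower-a (ℕ.n≤1+n _) (λ j≡0 → contradiction j≡0 (ℕ.>⇒≢ (proj₁ (base-j d)))) (base-rows d)
base-rows (last d)  = bot ℕ.≤-refl (right-rows d)

free-rows : ∀ {a j n N m g p} → Free a j n N m g p → Rows a a j n N m g
free-rows (up d)    = bot ℕ.≤-refl (free-rows d)
free-rows (right d) = lower-a (ℕ.n≤1+n _) (λ j≡0 → contradiction j≡0 (ℕ.>⇒≢ (proj₁ (free-j d))))
  (lower-h (ℕ.n≤1+n _) (free-rows d))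
free-rows (next d)  = lower-a (ℕ.n≤1+n _) (λ j≡0 → contradiction j≡0 (ℕ.>⇒≢ (proj₁ (base-j d)))) (base-rows d)

start-rows : ∀ {a ℓ j n N m g p} → Start a ℓ j n N m g p → Rows a (suc ℓ) j n N m g
start-rows (up d)    = bot ℕ.≤-refl (start-rows d)
start-rows (right d) = lower-a (ℕ.n≤1+n _) (λ j≡0 → contradiction j≡0 (ℕ.>⇒≢ (proj₁ (start-j d)))) (start-rows d)
start-rows (next d)  = lower-a (ℕ.n≤1+n _) (λ j≡0 → contradiction j≡0 (ℕ.>⇒≢ (proj₁ (free-j d)))) (free-rows d)

-- Half-perimeter of a path

-- This is the half-perimeter plus ℓ, free of truncated subtraction. The invariant below is that the
-- remaining half-perimeter plus the current ends of row and hole equals it; in `Free` both ends are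
-- at a, in `Start` the hole end is still ℓ.
size : ∀ {N D} → Vec ℕ N → Vec ℕ D → ℕ
size {N} {D} m g = N + (D + (at m N + at g D))

at-last : ∀ {k} x (v : Vec ℕ k) → 0 < k → at (x ∷ v) (suc k) ≡ at v k
at-last {suc k} x v _ = refl

advance : ∀ {p k s} → p + suc k ≡ s → suc p + k ≡ s
advance {p} eq = ≡.trans (≡.sym (ℕ.+-suc p _)) eq

size-∷ : ∀ {N D} x (m : Vec ℕ N) (g : Vec ℕ D) → 0 < N → size (x ∷ m) g ≡ suc (size m g)
size-∷ {suc N} x m g _ = refl

top-size : ∀ {b n N m g p} → Top b n N m g p → p + b ≡ N + at m N
top-size end = refl
top-size {N = suc N} {m = b ∷ m} (up d) =
  cong suc (≡.trans (top-size d) (cong (λ k → N + k) (≡.sym (at-last b m (top-N d)))))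
top-size (right d) = advance (top-size d)

-- If no hole row remains, the last hole end is the current y, whereas `at g 0` would give the
-- default 0. Prepending y to `g` covers both cases.
mid-size   : ∀ {y e n N m g p} → Mid y e n N m g p →
             p + (suc (e + y) + y) ≡ N + (n + (at m N + at (y ∷ g) (suc n)))
left-size  : ∀ {y e n N m g p} → Left y e n N m g p → p + (suc (e + y) + y) ≡ size m g
right-size : ∀ {y e n N m g p} → Right y e n N m g p → p + (suc (e + y) + y) ≡ size m g
mid-size {y} {e} {zero} {N} {m} {[]} {p} (fin d) = begin
  p + (suc (e + y) + y) ≡⟨ ℕ.+-assoc p _ y ⟨
  p + suc (e + y) + y   ≡⟨ cong (_+ y) (top-size d) ⟩
  N + at m N + y        ≡⟨ ℕ.+-assoc N _ y ⟩
  N + (at m N + y)      ∎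
mid-size {n = suc _} (fin d) = contradiction (top-n d) λ ()
mid-size {y} {n = n} {N} {m} {g} (more d) = ≡.trans (left-size d)
  (cong (λ k → N + (n + (at m N + k))) (≡.sym (at-last y g (left-n d))))
left-size {y} {suc e} {p = suc p} (shift d) = advance (≡.trans
  (cong (λ k → p + k) (≡.trans (≡.sym (ℕ.+-suc (suc (suc (e + y))) y)) (cong (λ k → suc k + suc y) (≡.sym (ℕ.+-suc e y)))))
  (left-size d))
left-size (stop d) = right-size d
right-size (right d) = advance (right-size d)
right-size {N = suc N} {x ∷ m} {y ∷ g} (up {n = n} d) = cong suc (≡.trans (cong suc (≡.trans (mid-size d)
  (cong (λ k → N + (n + (k + at (y ∷ g) (suc n)))) (≡.sym (at-last x m (ℕ.≤-<-trans z≤n (mid-N d)))))))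
  (≡.sym (ℕ.+-suc N _)))

base-size : ∀ {y f j n N m g p} → Base y f j n N m g p → p + (suc (f + y) + y) ≡ size m g
base-size {m = x ∷ m} {g} (up d) =
  ≡.trans (cong suc (base-size d)) (≡.sym (size-∷ x m g (ℕ.≤-<-trans z≤n (base-N d))))
base-size (right d) = advance (base-size d)
base-size {m = x ∷ m} {g} (last d) =
  ≡.trans (cong suc (right-size d)) (≡.sym (size-∷ x m g (ℕ.≤-<-trans z≤n (right-N d))))

advance² : ∀ {p a s} → p + (suc a + suc a) ≡ s → suc (suc p) + (a + a) ≡ s
advance² {p} {a} eq = advance {suc p} (advance {p} (≡.trans (cong (λ k → p + k) (≡.sym (ℕ.+-suc (suc a) a))) eq))

free-size : ∀ {a j n N m g p} → Free a j n N m g p → p + (a + a) ≡ size m g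
free-size {m = x ∷ m} {g} (up d) =
  ≡.trans (cong suc (free-size d)) (≡.sym (size-∷ x m g (ℕ.≤-<-trans z≤n (free-N d))))
free-size (right d) = advance² (free-size d)
free-size (next d)  = advance (base-size d)

start-size : ∀ {a ℓ j n N m g p} → Start a ℓ j n N m g p → p + (a + ℓ) ≡ size m g
start-size {m = x ∷ m} {g} (up d) =
  ≡.trans (cong suc (start-size d)) (≡.sym (size-∷ x m g (ℕ.≤-<-trans z≤n (start-N d))))
start-size (right d) = advance (start-size d)
start-size (next d)  = advance² (free-size d)

-- Every diagram is traced by a path

-- Supplies runs of `right` steps: a path from width k is prolonged backwards to a smaller width i.
-- The order `≤‴` is used because its induction moves the lower end.
descend : (S : ℕ → Set) → (∀ {i} → S (suc i) → S i) → ∀ {i k} → i ≤ k → S k → S i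
descend S step i≤k = go (ℕ.≤⇒≤‴ i≤k)
  where
  go : ∀ {i k} → i ≤‴ k → S k → S i
  go ≤‴-refl       s = s
  go (≤‴-step i<k) s = step (go i<k s)

split : ∀ {z x} → z < x → ∃ λ k → x ≡ suc (k + z)
split {z} {x} z<x with k , refl ← ℕ.m≤n⇒∃[o]m+o≡n z<x = k , cong suc (ℕ.+-comm z k)

-- The half-perimeter of the path is left existential here and below; the size invariant determines
-- it afterwards.
top-path : ∀ {b h N m} → Rows b h 0 0 N m [] → 0 < N → ∃ (Top b 0 N m [])
top-path {N = N} {m} (top {x} {N = N′} {m = m′} b≤x r) _ =
  descend (λ b → ∃ (Top b 0 N m [])) (λ (p , d) → suc p , right d) b≤x (first r)
  where
  first : Rows x _ 0 0 N′ m′ [] → ∃ (Top x 0 (suc N′) (x ∷ m′) [])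
  first nil = _ , end
  first r@(top _ _) = let p , d = top-path r (s≤s z≤n) in suc p , up d

left-path : ∀ {y z} e e′ {n N m g} → y ≤‴ z → e + y ≡ e′ + z →
  ∃ (Right z e′ n N m g) → ∃ (Left y e n N m g)
left-path {y} e e′ ≤‴-refl eq (p , d) with refl ← ℕ.+-cancelʳ-≡ y e e′ eq = p , stop d
left-path {y} {z} zero e′ (≤‴-step y<z) eq _ =
  contradiction (ℕ.≤-trans (ℕ.≤‴⇒≤ y<z) (ℕ.m≤n+m z e′)) (ℕ.<⇒≱ (s≤s (ℕ.≤-reflexive (≡.sym eq))))
left-path {y} (suc e) e′ (≤‴-step y<z) eq d =
  let p , d = left-path e e′ y<z (≡.trans (ℕ.+-suc e y) eq) d in suc p , shift d

mid-path : ∀ {a h} e {n N m g} → a ≡ suc (e + h) → Rows a h 0 n N m g → n < N → ∃ (Mid h e n N m g)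
right-path : ∀ {a h z} k {n N m g} → a ≡ suc (k + z) → Rows a h 0 (suc n) N m (z ∷ g) → suc n < N →
  ∃ (Right z k (suc n) N m (z ∷ g))
mid-path e refl r@(top _ _) 0<N = let p , d = top-path r 0<N in p , fin d
mid-path e refl r@(mid _ h≤z z<a _) n<N =
  let k , eq = split z<a
      p , d  = left-path e k (ℕ.≤⇒≤‴ h≤z) (ℕ.suc-injective eq) (right-path k eq r n<N)
  in p , more d
right-path {z = z} k refl (mid {N = N} {m = m} {g = g} a≤x h≤z z<a r) (s≤s n<N)
  with k′ , refl ← split (ℕ.<-≤-trans z<a a≤x) =
  let p , d = mid-path k′ refl r n<N
  in descend (λ k → ∃ (Right z k _ (suc N) (suc (k′ + z) ∷ m) (z ∷ g))) (λ (p , d) → suc p , right d)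
       (ℕ.+-cancelʳ-≤ z k k′ (s≤s⁻¹ a≤x)) (_ , up d)

base-path : ∀ {a h y} f {j n N m g} → a ≡ suc (f + y) → Rows a h (suc j) n N m g →
  suc j < n → n < N → at g 1 ≡ y → ∃ (Base y f (suc j) n N m g)
base-path {y = y} f refl (bot {j = j} {n = n} {N = N} {m = m} {g = g} a≤x r) (s≤s j<n) (s≤s n<N) eq
  with k , refl ← split (ℕ.<-≤-trans (s≤s (ℕ.m≤n+m y f)) a≤x) =
  descend (λ f → ∃ (Base y f (suc j) (suc n) (suc N) (suc (k + y) ∷ m) g)) (λ (p , d) → suc p , right d)
    (ℕ.+-cancelʳ-≤ y f k (s≤s⁻¹ a≤x)) (first r j<n eq)
  where
  first : ∀ {j g} → Rows (suc (k + y)) _ j n N m g → j < n → at g 1 ≡ y →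
    ∃ (Base y k (suc j) (suc n) (suc N) (suc (k + y) ∷ m) g)
  first {zero} r@(mid _ _ _ _) j<n refl = let p , d = right-path k refl r n<N in suc p , last d
  first {suc j} r j<n eq = let p , d = base-path k refl r j<n n<N eq in suc p , up d

-- A row ending at or before the first hole end is completed within `Free`; for the first longer one
-- the path runs right to exactly that column and enters `Base` at distance 0.
free-path : ∀ {a h j n N m g} → Rows a h (suc j) n N m g →
  suc j < n → n < N → a ≤ at g 1 → ∃ (Free a (suc j) n N m g)
free-path (bot {x} {j = j} {n = n} {N = N} {m = m} {g = g} a≤x r) (s≤s j<n) (s≤s n<N) a≤z with x ≤? at g 1
... | yes x≤z = descend S (λ (p , d) → _ , right d) a≤x (first r j<n x≤z)
  where
  S : ℕ → Set
  S a = ∃ (Free a (suc j) (suc n) (suc N) (x ∷ m) g)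
  first : ∀ {j g} → Rows x _ j n N m g → j < n → x ≤ at g 1 → ∃ (Free x (suc j) (suc n) (suc N) (x ∷ m) g)
  -- Row j is longer than the first hole end, so a row that is not longer cannot be the last one
  -- below the hole.
  first {zero} (mid _ _ z<x _) j<n x≤z = contradiction x≤z (ℕ.<⇒≱ z<x)
  first {suc j} r j<n x≤z = let p , d = free-path r j<n n<N x≤z in suc p , up d
... | no x≰z = descend S (λ (p , d) → _ , right d) a≤z
  (let p , d = base-path 0 refl (bot (ℕ.≰⇒> x≰z) r) (s≤s j<n) (s≤s n<N) refl in suc p , next d)
  where
  S : ℕ → Set
  S a = ∃ (Free a (suc j) (suc n) (suc N) (x ∷ m) g)

start-path : ∀ {a h ℓ j n N m g} → Rows a h (suc j) n N m g →
  suc j < n → n < N → a ≤ ℓ → ℓ < at g 1 → ∃ (Start a ℓ (suc j) n N m g)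
start-path {ℓ = ℓ} (bot {x} {j = j} {n = n} {N = N} {m = m} {g = g} a≤x r) (s≤s j<n) (s≤s n<N) a≤ℓ ℓ<z with x ≤? ℓ
... | yes x≤ℓ = descend S (λ (p , d) → _ , right d) a≤x (first r j<n ℓ<z)
  where
  S : ℕ → Set
  S a = ∃ (Start a ℓ (suc j) (suc n) (suc N) (x ∷ m) g)
  first : ∀ {j g} → Rows x _ j n N m g → j < n → ℓ < at g 1 → ∃ (Start x ℓ (suc j) (suc n) (suc N) (x ∷ m) g)
  first {zero} (mid _ _ z<x _) j<n ℓ<z = contradiction (ℕ.≤-trans x≤ℓ (ℕ.<⇒≤ ℓ<z)) (ℕ.<⇒≱ z<x)
  first {suc j} r j<n ℓ<z = let p , d = start-path r j<n n<N x≤ℓ ℓ<z in suc p , up d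
... | no x≰ℓ = descend S (λ (p , d) → _ , right d) a≤ℓ
  (let p , d = free-path (bot (ℕ.≰⇒> x≰ℓ) r) (s≤s j<n) (s≤s n<N) ℓ<z in _ , next d)
  where
  S : ℕ → Set
  S a = ∃ (Start a ℓ (suc j) (suc n) (suc N) (x ∷ m) g)

-- Paths and wicketed diagrams

-- Prepending a as row 0 turns the bound on the first row into an instance of monotonicity.
Monotone : ∀ {N} → ℕ → Vec ℕ N → Set
Monotone {N} a m = ∀ i → i < N → at (a ∷ m) (suc i) ≤ at (a ∷ m) (suc (suc i))

-- Likewise h acts as a hole end of index 0. With a = 1, h = ℓ + 1 and j positive, the instance k =
-- 0 says that the first hole end lies beyond ℓ and below the length of row j.
Nested : ∀ {N D} → ℕ → ℕ → ℕ → Vec ℕ N → Vec ℕ D → Set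
Nested {N} {D} a h j m g = ∀ k → k < D →
  at (h ∷ g) (suc k) ≤ at (h ∷ g) (suc (suc k)) × at (h ∷ g) (suc (suc k)) < at (a ∷ m) (suc (j + k))

rows-monotone : ∀ {a h j n N m g} → Rows a h j n N m g → Monotone a m
rows-monotone (top a≤x r)     zero    _         = a≤x
rows-monotone (mid a≤x _ _ r) zero    _         = a≤x
rows-monotone (bot a≤x r)     zero    _         = a≤x
rows-monotone (top _ r)       (suc i) (s≤s i<N) = rows-monotone r i i<N
rows-monotone (mid _ _ _ r)   (suc i) (s≤s i<N) = rows-monotone r i i<N
rows-monotone (bot _ r)       (suc i) (s≤s i<N) = rows-monotone r i i<N

rows-nested : ∀ {a h j n N m g} → Rows a h j n N m g → Nested a h j m g
rows-nested (mid _ h≤z z<a r) zero    _         = h≤z , z<a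
rows-nested (mid _ _ _ r)     (suc k) (s≤s k<D) = rows-nested r k k<D
rows-nested (bot _ r)         k       k<D       = rows-nested r k k<D

rows : ∀ {a h} j n N (m : Vec ℕ N) (g : Vec ℕ (n ∸ j)) → j ≤ n → n ≤ N →
  Monotone a m → Nested a h j m g → Rows a h j n N m g
rows zero zero zero [] [] _ _ mono nest = nil
rows zero zero (suc N) (x ∷ m) [] _ _ mono nest =
  top (mono 0 (s≤s z≤n)) (rows 0 0 N m [] z≤n z≤n (λ i → mono (suc i) ∘ s≤s) (λ _ ()))
rows zero (suc n) (suc N) (x ∷ m) (z ∷ g) _ (s≤s n≤N) mono nest =
  let h≤z , z<a = nest 0 (s≤s z≤n)
  in mid (mono 0 (s≤s z≤n)) h≤z z<a
       (rows 0 n N m g z≤n n≤N (λ i → mono (suc i) ∘ s≤s) (λ k → nest (suc k) ∘ s≤s))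
rows (suc j) (suc n) (suc N) (x ∷ m) g (s≤s j≤n) (s≤s n≤N) mono nest =
  bot (mono 0 (s≤s z≤n)) (rows j n N m g j≤n n≤N (λ i → mono (suc i) ∘ s≤s) nest)

-- The extra unit pays for the first column, since the path starts at width 1. It is the factor t in
-- `W-eq`.
data Outline : ℕ → Shape where
  outline : ∀ {ℓ j n N m g p} → Start 1 ℓ j n N m g p → Outline ℓ j n N m g (suc p)

outline-unique : ∀ {ℓ j n N m g p} (c d : Outline ℓ j n N m g p) → c ≡ d
outline-unique (outline c) (outline d) = cong outline (start-unique c d)

outline↔ : ∀ p → Fin (#wfd p) ↔ Totalℓ Outline p
outline↔ zero    = Fin0↔ λ { (tot ()) }
outline↔ (suc p) = step ↔-∘ start↔ p 1
  where
  step : Totalℓ (Start 1) p ↔ Totalℓ Outline (suc p)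
  step = mk↔ₛ′ (λ { (tot d) → tot (outline d) }) (λ { (tot (outline d)) → tot d })
    (λ { (tot (outline d)) → refl }) (λ { (tot d) → refl })

-- Translating between row-indexed and vector-indexed conditions

<∸⇒+< : ∀ j {i n} → i < n ∸ j → j + i < n
<∸⇒+< zero            i<n   = i<n
<∸⇒+< (suc j) {n = suc n} i<n∸j = s≤s (<∸⇒+< j i<n∸j)

+<⇒<∸ : ∀ j {i n} → j + i < n → i < n ∸ j
+<⇒<∸ zero    i<n         = i<n
+<⇒<∸ (suc j) (s≤s j+i<n) = +<⇒<∸ j j+i<n

index₁ : ∀ j i → suc (j + i) ∸ j ≡ suc i
index₁ j i = ≡.trans (cong (_∸ j) (≡.sym (ℕ.+-suc j i))) (ℕ.m+n∸m≡n j (suc i))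

index₂ : ∀ j i → suc (suc (j + i)) ∸ j ≡ suc (suc i)
index₂ j i = ≡.trans (cong (λ k → suc k ∸ j) (≡.sym (ℕ.+-suc j i))) (index₁ j (suc i))

module _ {N D : ℕ} (a h j : ℕ) (m : Vec ℕ N) (g : Vec ℕ D) (nest : Nested a h j m g) where

  nested-lower : ∀ k → k < D → h ≤ at g (suc k)
  nested-lower zero    0<D = proj₁ (nest 0 0<D)
  nested-lower (suc k) k<D = ℕ.≤-trans (nested-lower k (ℕ.<⇒≤ k<D)) (proj₁ (nest (suc k) k<D))

nested-last : ∀ {N D} a h j (m : Vec ℕ N) (g : Vec ℕ D) → Nested a h j m g → 0 < D → h ≤ at g D
nested-last {D = suc D} a h j m g nest _ = nested-lower a h j m g nest D ℕ.≤-refl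

All⇒monotone : ∀ {N} {m : Vec ℕ N} → 1 ≤ at m 1 →
  All (λ i → at m i ≤ at m (suc i)) (range 1 (N ∸ 1)) → Monotone 1 m
All⇒monotone {N} 1≤m₁ mono zero    _   = 1≤m₁
All⇒monotone {N} 1≤m₁ mono (suc i) i<N = All.applyUpTo⁻ (λ i → 1 + i) (N ∸ 1) mono (ℕ.∸-monoˡ-≤ 1 i<N)

monotone⇒All : ∀ {N} {m : Vec ℕ N} → Monotone 1 m → All (λ i → at m i ≤ at m (suc i)) (range 1 (N ∸ 1))
monotone⇒All {N} mono = All.applyUpTo⁺₁ (λ i → 1 + i) (N ∸ 1) λ {i} i<N∸1 → mono (suc i) (<∸⇒+< 1 i<N∸1)

module _ (j n N ℓ : ℕ) (m : Vec ℕ N) (g : Vec ℕ (n ∸ suc j)) where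

  private
    J : ℕ
    J = suc j
    Hole HoleMono : Set
    Hole = All (λ i → ℓ < at g (i ∸ J) × at g (i ∸ J) < at m i) (range (suc J) n)
    HoleMono = All (λ i → at g (i ∸ J) ≤ at g (suc i ∸ J) × at g (suc i ∸ J) < at m i)
                   (range (suc J) (n ∸ 1))

  All⇒nested : Hole → at g 1 < at m J → HoleMono → Nested 1 (suc ℓ) J m g
  All⇒nested hole bottom _ zero 0<D =
    ≡.subst (λ i → ℓ < at g i) (index₁ J 0) (proj₁ (All.applyUpTo⁻ (λ i → suc J + i) (n ∸ J) hole 0<D))
    , ≡.subst (λ i → at g 1 < at m (suc i)) (≡.sym (ℕ.+-identityʳ j)) bottom
  All⇒nested _ _ hole-mono (suc k) k<D =
    ≡.subst₂ (λ i i′ → at g i ≤ at g i′) (index₁ J k) (index₂ J k) (proj₁ here)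
    , ≡.subst₂ (λ i i′ → at g i < at m i′) (index₂ J k) (cong suc (≡.sym (ℕ.+-suc j k))) (proj₂ here)
    where
    here = All.applyUpTo⁻ (λ i → suc J + i) (n ∸ 1 ∸ J) hole-mono
      (+<⇒<∸ J (+<⇒<∸ 1 (≡.subst (_< n) (ℕ.+-suc J k) (<∸⇒+< J k<D))))

  nested⇒bottom : J < n → Nested 1 (suc ℓ) J m g → at g 1 < at m J
  nested⇒bottom J<n nest =
    ≡.subst (λ i → at g 1 < at m (suc i)) (ℕ.+-identityʳ j) (proj₂ (nest 0 (ℕ.m<n⇒0<n∸m J<n)))

  -- A hole end is below the length of the previous row, hence below that of its own row by
  -- monotonicity; the bound by ℓ propagates upward from the first hole end.
  nested⇒hole : n < N → Monotone 1 m → Nested 1 (suc ℓ) J m g → Hole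
  nested⇒hole n<N mono nest = All.applyUpTo⁺₁ (λ i → suc J + i) (n ∸ J) λ {k} k<D →
    ≡.subst (λ i → ℓ < at g i × at g i < at m (suc (J + k))) (≡.sym (index₁ J k))
      ( nested-lower 1 (suc ℓ) J m g nest k k<D
      , ℕ.<-≤-trans (proj₂ (nest k k<D)) (mono (J + k) (ℕ.<-trans (<∸⇒+< J k<D) n<N)))

  nested⇒hole-mono : Nested 1 (suc ℓ) J m g → HoleMono
  nested⇒hole-mono nest = All.applyUpTo⁺₁ (λ i → suc J + i) (n ∸ 1 ∸ J) λ {k} k<D →
    let g≤ , g< = nest (suc k) (+<⇒<∸ J (≡.subst (_< n) (≡.sym (ℕ.+-suc J k)) (<∸⇒+< 1 (<∸⇒+< J k<D))))
    in ≡.subst₂ (λ i i′ → at g i ≤ at g i′) (≡.sym (index₁ J k)) (≡.sym (index₂ J k)) g≤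
     , ≡.subst₂ (λ i i′ → at g i < at m i′) (≡.sym (index₂ J k)) (cong suc (ℕ.+-suc j k)) g<

perimeter+ℓ : ∀ {N D} (m : Vec ℕ N) (g : Vec ℕ D) {ℓ} → ℓ ≤ at g D →
  at m N + N + D + (at g D ∸ ℓ) + ℓ ≡ size m g
perimeter+ℓ {N} {D} m g {ℓ} ℓ≤ = begin
  at m N + N + D + (at g D ∸ ℓ) + ℓ    ≡⟨ ℕ.+-assoc (at m N + N + D) _ ℓ ⟩
  at m N + N + D + (at g D ∸ ℓ + ℓ)    ≡⟨ cong (λ k → at m N + N + D + k) (ℕ.m∸n+n≡m ℓ≤) ⟩
  at m N + N + D + at g D              ≡⟨ solve 4 (λ a n d b → a :+ n :+ d :+ b := n :+ (d :+ (a :+ b)))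
                                            refl (at m N) N D (at g D) ⟩
  size m g                             ∎
  where
  open +-*-Solver using (solve; _:+_; _:=_)

start-perimeter : ∀ {ℓ j n N m g q} → Start 1 ℓ j n N m g q → ℓ ≤ at g (n ∸ j) →
  at m N + N + (n ∸ j) + (at g (n ∸ j) ∸ ℓ) ≡ suc q
start-perimeter {ℓ} {m = m} {g} {q} d ℓ≤ = ℕ.+-cancelʳ-≡ ℓ _ _
  (≡.trans (perimeter+ℓ m g ℓ≤) (≡.trans (≡.sym (start-size d)) (ℕ.+-suc q ℓ)))

toOutline : ∀ {p} (x : WFD p) → Outline (WFD.ℓ x) (WFD.j x) (WFD.n x) (WFD.N x) (WFD.m x) (WFD.g x) p
toOutline record { j = suc j ; n = n ; N = N ; ℓ = ℓ ; m = m ; g = g ; 1≤j = s≤s _ ; j<n = j<n ; n<N = n<N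
                 ; 1≤ℓ = 1≤ℓ ; 1≤m₁ = 1≤m₁ ; m-mono = m-mono ; hole = hole ; bottom = bottom
                 ; hole-mono = hole-mono ; perim = perim } =
  let nest  = All⇒nested j n N ℓ m g hole bottom hole-mono
      0<D   = ℕ.m<n⇒0<n∸m j<n
      q , d = start-path (rows (suc j) n N m g (ℕ.<⇒≤ j<n) (ℕ.<⇒≤ n<N) (All⇒monotone 1≤m₁ m-mono) nest)
                j<n n<N 1≤ℓ (proj₁ (nest 0 0<D))
  -- The constructed path brings its own half-perimeter `suc q`, which equals p because both are
  -- given by the same formula in the data.
  in ≡.subst (Outline ℓ (suc j) n N m g)
       (≡.trans (≡.sym (start-perimeter d (ℕ.<⇒≤ (nested-last 1 (suc ℓ) (suc j) m g nest 0<D)))) perim) (outline d)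

fromOutline : ∀ {ℓ j n N m g p} → Outline ℓ j n N m g p → WFD p
fromOutline {j = zero} (outline d) = contradiction (proj₁ (start-j d)) λ ()
fromOutline {ℓ} {suc j} {n} {N} {m} {g} (outline d) = record
  { j = suc j ; n = n ; N = N ; ℓ = ℓ ; m = m ; g = g
  ; 1≤j = s≤s z≤n ; j<n = j<n ; n<N = n<N ; 1≤ℓ = start-ℓ d ; 1≤m₁ = start-m d
  ; m-mono = monotone⇒All mono
  ; hole = nested⇒hole j n N ℓ m g n<N mono nest
  ; bottom = nested⇒bottom j n N ℓ m g j<n nest
  ; hole-mono = nested⇒hole-mono j n N ℓ m g nest
  ; perim = start-perimeter d (ℕ.<⇒≤ (nested-last 1 (suc ℓ) (suc j) m g nest (ℕ.m<n⇒0<n∸m j<n)))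
  }
  where
  j<n  = proj₂ (start-j d)
  n<N  = start-N d
  mono = rows-monotone (start-rows d)
  nest = rows-nested (start-rows d)

-- The remaining fields of `WFD` are propositions, and a path is unique for given data, so both
-- round trips of the bijection need only be compared on these components.
Raw : Set
Raw = ∃ λ j → ∃ λ n → ∃ λ N → ℕ × Vec ℕ N × Vec ℕ (n ∸ j)

raw : ∀ {p} → WFD p → Raw
raw x = WFD.j x , WFD.n x , WFD.N x , WFD.ℓ x , WFD.m x , WFD.g x

raw-fromOutline : ∀ {ℓ j n N m g p} (d : Outline ℓ j n N m g p) → raw (fromOutline d) ≡ (j , n , N , ℓ , m , g)
raw-fromOutline {j = zero}  (outline d) = contradiction (proj₁ (start-j d)) λ ()
raw-fromOutline {j = suc _} (outline d) = refl

×-irrelevant : ∀ {a b c d} (x y : a ≤ b × c ≤ d) → x ≡ y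
×-irrelevant (x , y) (x′ , y′) = cong₂ _,_ (ℕ.≤-irrelevant x x′) (ℕ.≤-irrelevant y y′)

raw-injective : ∀ {p} (x y : WFD p) → raw x ≡ raw y → x ≡ y
raw-injective record { 1≤j = a ; j<n = b ; n<N = c ; 1≤ℓ = d ; 1≤m₁ = e ; m-mono = f ; hole = h
                     ; bottom = k ; hole-mono = l ; perim = o }
              record { 1≤j = a′ ; j<n = b′ ; n<N = c′ ; 1≤ℓ = d′ ; 1≤m₁ = e′ ; m-mono = f′ ; hole = h′
                     ; bottom = k′ ; hole-mono = l′ ; perim = o′ } refl
  rewrite ℕ.≤-irrelevant a a′ | ℕ.≤-irrelevant b b′ | ℕ.≤-irrelevant c c′ | ℕ.≤-irrelevant d d′
        | ℕ.≤-irrelevant e e′ | All.irrelevant ℕ.≤-irrelevant f f′ | All.irrelevant ×-irrelevant h h′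
        | ℕ.≤-irrelevant k k′ | All.irrelevant ×-irrelevant l l′ | ℕ.≡-irrelevant o o′ = refl

rawTotal : ∀ {p} → Totalℓ Outline p → Raw
rawTotal (tot {ℓ} {j} {n} {N} {m} {g} _) = j , n , N , ℓ , m , g

rawTotal-injective : ∀ {p} (c d : Totalℓ Outline p) → rawTotal c ≡ rawTotal d → c ≡ d
rawTotal-injective (tot c) (tot d) refl = cong (λ d → tot d) (outline-unique c d)

wfd↔ : ∀ p → WFD p ↔ Totalℓ Outline p
wfd↔ p = mk↔ₛ′ to from to∘from (λ x → raw-injective (from (to x)) x (raw-fromOutline (toOutline x)))
  where
  to : WFD p → Totalℓ Outline p
  to x = tot (toOutline x)
  from : Totalℓ Outline p → WFD p
  from (tot d) = fromOutline d
  to∘from : ∀ d → to (from d) ≡ d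
  to∘from (tot d) = rawTotal-injective (to (fromOutline d)) (tot d) (raw-fromOutline d)

#wfd-correct : ∀ w p → Fin w ↔ WFD p → w ≡ #wfd p
#wfd-correct w p count = ↔⇒≡ (↔-sym (outline↔ p) ↔-∘ (wfd↔ p ↔-∘ count))

theorem2 : (w : ℕ → ℕ) → (∀ p → Fin (w p) ↔ WFD p) →
    ∀ k → ((2t-1 ^^ 8) ⊛ series w ⊛ series w
            ⊖ tpow 6 ⊛ (2t-1 ^^ 4) ⊛ series w
            ⊕ tpow 14) k ≡ + 0
theorem2 w count = coeff (≈-trans
  (⊕-cong (⊕-cong (⊛-cong (⊛-cong {2t-1 ^^ 8} ≈-refl w≈) w≈)
                  (⊝-cong (⊛-cong {tpow 6 ⊛ (2t-1 ^^ 4)} ≈-refl w≈))) (≈-refl {tpow 14}))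
  #wfd-quadratic)
  where
  w≈ : series w ≈ series #wfd
  w≈ = pointwise λ p → cong +_ (#wfd-correct (w p) p (count p))
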